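{- Let $Q$ be an odd prime power. Then: (a) $F_6(X):=X-\mathrm{Tr}_{Q^4/Q^2}(X^{Q^3+Q^2-Q})$ permutes $\mathbb{F}_{Q^4}$; (b) for any nonsquare $\nu\in\mathbb{F}_{Q^2}$, the function $x\mapsto \dfrac{x^{Q+2}+3\nu x^Q-4\nu^{(Q+1)/2}x}{x^2-\nu}$ permutes $\mathbb{F}_{Q^2}$; (c) $\dfrac{X^{2Q+1}-X^{Q+1}+1}{X^{2Q+1}-X^{Q}+1}$ permutes the set of $(Q^2+1)$-th roots of unity in $\mathbb{F}_{Q^4}^*$.
   Context: $\mathrm{Tr}_{Q^4/Q^2}(X)$ denotes the polynomial $X^{Q^2}+X$. "Permutes" means the induced map on the given set is well-defined and bijective. -}

module Defs where

open import Level using (0ℓ)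
open import Data.Nat as ℕ using (ℕ; zero; suc)
open import Data.Fin using (Fin)
open import Data.Unit using (⊤)
open import Data.Product using (Σ; ∃; _×_; _,_)
open import Data.Nat.Primality using (Prime)
open import Relation.Binary.PropositionalEquality using (_≡_; _≢_)
open import Relation.Nullary using (¬_)
open import Algebra.Structures using (IsCommutativeRing)
open import Function.Bundles using (_↔_)

-- A field, with propositional equality as its equality.
-- The multiplicative inverse is a total function whose value at 0 is
-- unconstrained; it is only ever used at nonzero arguments.
record Field : Set₁ where
  infixl 6 _+_ _-_
  infixl 7 _*_
  field
    Carrier : Set
    _+_ _*_ : Carrier → Carrier → Carrier
    -_      : Carrier → Carrier
    0# 1#   : Carrier
    isCommutativeRing : IsCommutativeRing _≡_ _+_ _*_ -_ 0# 1#
    _⁻¹     : Carrier → Carrier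
    0≢1     : 0# ≢ 1#
    inverseʳ : ∀ x → x ≢ 0# → x * (x ⁻¹) ≡ 1#

  _-_ : Carrier → Carrier → Carrier
  x - y = x + (- y)

  infixr 8 _^_
  _^_ : Carrier → ℕ → Carrier
  x ^ zero  = 1#
  x ^ suc n = x * (x ^ n)

  fromℕ : ℕ → Carrier
  fromℕ zero    = 0#
  fromℕ (suc n) = 1# + fromℕ n

record FiniteField (n : ℕ) : Set₁ where
  field
    field' : Field
  open Field field' public
  field
    enumeration : Carrier ↔ Fin n

IsOddPrimePower : ℕ → Set
IsOddPrimePower Q =
  Σ ℕ λ p → Σ ℕ λ k → Prime p × p ≢ 2 × 1 ℕ.≤ k × Q ≡ p ℕ.^ k

PermutesOn : {A : Set} → (A → Set) → (A → A) → Set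
PermutesOn {A} S f =
  (∀ x → S x → S (f x)) ×
  (∀ x y → S x → S y → f x ≡ f y → x ≡ y) ×
  (∀ y → S y → Σ A λ x → S x × f x ≡ y)

-- The rational function N/D permutes S: D does not vanish on S (so the
-- induced map x ↦ N(x)/D(x) is defined on S) and that map permutes S.
PermutesRat : (F : Field) → (Field.Carrier F → Set) →
              (Field.Carrier F → Field.Carrier F) →
              (Field.Carrier F → Field.Carrier F) → Set
PermutesRat F S N D =
  (∀ x → S x → D x ≢ 0#) × PermutesOn S (λ x → N x * (D x ⁻¹))
  where open Field F

module Thm7p1 (Q : ℕ) (K : FiniteField (Q ℕ.^ 4)) where
  open FiniteField K

  Tr : Carrier → Carrier
  Tr x = x ^ (Q ℕ.^ 2) + x

  InFQ2 : Carrier → Set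
  InFQ2 x = x ^ (Q ℕ.^ 2) ≡ x

  NonsquareFQ2 : Carrier → Set
  NonsquareFQ2 ν = ¬ (Σ Carrier λ y → InFQ2 y × y * y ≡ ν)

  μ : Carrier → Set
  μ x = x ≢ 0# × x ^ (Q ℕ.^ 2 ℕ.+ 1) ≡ 1#

  F₆ : Carrier → Carrier
  F₆ x = x - Tr (x ^ (Q ℕ.^ 3 ℕ.+ Q ℕ.^ 2 ℕ.∸ Q))

  numB denB : Carrier → Carrier → Carrier
  numB ν x = x ^ (Q ℕ.+ 2) + fromℕ 3 * ν * x ^ Q
             - fromℕ 4 * ν ^ ((Q ℕ.+ 1) ℕ./ 2) * x
  denB ν x = x ^ 2 - ν

  numC denC : Carrier → Carrier
  numC x = x ^ (2 ℕ.* Q ℕ.+ 1) - x ^ (Q ℕ.+ 1) + 1#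
  denC x = x ^ (2 ℕ.* Q ℕ.+ 1) - x ^ Q + 1#

  Claim : Set
  Claim =
    PermutesOn (λ _ → ⊤) F₆ ×
    (∀ ν → InFQ2 ν → NonsquareFQ2 ν →
       PermutesRat field' InFQ2 (numB ν) (denB ν)) ×
    PermutesRat field' μ numC denC

{-# OPTIONS --safe #-}
module Submission where

-- Write φ x = x^Q.  In all three parts a point x is encoded by a (Q² + 1)-th root of unity z: in (a)
-- z = x / x^{Q²}, in (b) z = (x + b) / (x − b) with b² = ν, and two points with the same image give
-- roots of unity z, y in the same fibre of the map of (c); surjectivity follows by finiteness.
-- Put Z = φ z and Y = φ y, so that φ Z = 1/z and φ Y = 1/y.  The equation of a fibre and its image
-- under φ define a generically dihedral cover of degree 5: they imply (z − y) A B = 0 for two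
-- explicit polynomials A, B in z, Z, y, Y cutting out the adjacent and the diagonal pairs of vertices
-- of a pentagon.  As φ interchanges A and B, a pair z ≠ y in the same fibre satisfies A = B = 0,
-- hence (z + ZY)(y + ZY) = 0, and applying φ once more to the vanishing factor forces z = y.

-- Written with powers of Q, the equations have unbounded degree. Treating z, Z, y, Y as
-- independent, and using of φ only that it is a ring endomorphism with z · φ²z = 1, leaves
-- identities of small fixed degree over the integers, which a ring solver can check. The encodings
-- work because they turn (a) and (b) into the map r of (c). If c is the value of (a) at some x ≠
-- φ²x, then c / φ²c = r(z); if h is the value of (b) at x, then (h - φb) / (h + φb) = φ(r(z)). The
-- obstacle is that, over independent variables, a fibre really has several points: the vertices of
-- the pentagon. No consequence of the two fibre equations alone can give z = y, so φ has to act on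
-- the factors A and B themselves.

open import Defs
open import Algebra.Bundles using (CommutativeRing)
open import Algebra.Properties.CommutativeMonoid.Sum as Sum using ()
open import Data.Fin as Fin using (Fin; punchIn; punchOut; inject≤) renaming (zero to fzero; suc to fsuc)
import Data.Fin.Properties as Fin
open import Data.Fin.Permutation using (Permutation)
open import Data.Integer as ℤ using (ℤ; -[1+_]; _⊖_; _◃_) renaming (+_ to pos)
import Data.Integer.Properties as ℤ
open import Data.Maybe using (Maybe; just; nothing)
open import Data.Nat as ℕ using (ℕ; zero; suc; _^_; z≤n; s≤s)
open import Data.Nat.Combinatorics using (_C_; nCn≡1; k>n⇒nCk≡0; nCk+nC[k+1]≡[n+1]C[k+1])
open import Data.Nat.Divisibility using (_∣_; divides; >⇒∤)
import Data.Nat.DivMod as ℕ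
open import Data.Nat.Primality using (Prime; euclidsLemma; prime⇒irreducible; ¬prime[0])
import Data.Nat.Properties as ℕ
open import Data.Nat.Solver using (module +-*-Solver)
open import Data.Product using (Σ; ∃; _×_; _,_; proj₁; proj₂)
import Data.Sign as Sign
open import Data.Sum using (_⊎_; inj₁; inj₂)
open import Data.Unit using (⊤; tt)
open import Data.Vec as Vec using (Vec; []; _∷_; replicate)
import Data.Vec.Properties as Vec
open import Function using (_∘_; mk↔ₛ′; Inverse)
open import Function.Definitions using (Injective)
open import Relation.Binary.PropositionalEquality using (_≡_; _≢_; refl; sym; trans; cong; cong₂; subst; module ≡-Reasoning)
open import Relation.Binary.Definitions using (DecidableEquality)
open import Relation.Nullary using (¬_; Dec; yes; no; contradiction)

-- Arithmetic of ℕ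

-- The absorption identity, kept free of division so that Euclid's lemma applies to its left side.
[1+k]*[1+n]C[1+k]≡[1+n]*nCk : ∀ n k → suc k ℕ.* (suc n C suc k) ≡ suc n ℕ.* (n C k)
[1+k]*[1+n]C[1+k]≡[1+n]*nCk zero zero = refl
[1+k]*[1+n]C[1+k]≡[1+n]*nCk zero (suc k)
  rewrite k>n⇒nCk≡0 {1} {suc (suc k)} (s≤s (s≤s z≤n)) | k>n⇒nCk≡0 {0} {suc k} (s≤s z≤n) = ℕ.*-zeroʳ k
[1+k]*[1+n]C[1+k]≡[1+n]*nCk (suc n) zero = begin
  1 ℕ.* (suc (suc n) C 1)               ≡⟨ cong (1 ℕ.*_) (nCk+nC[k+1]≡[n+1]C[k+1] (suc n) 0) ⟨
  1 ℕ.* (1 ℕ.+ (suc n C 1))             ≡⟨ ℕ.*-distribˡ-+ 1 1 (suc n C 1) ⟩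
  1 ℕ.+ 1 ℕ.* (suc n C 1)               ≡⟨ cong (1 ℕ.+_) ([1+k]*[1+n]C[1+k]≡[1+n]*nCk n 0) ⟩
  suc (suc n) ℕ.* 1                     ∎
  where open ≡-Reasoning
[1+k]*[1+n]C[1+k]≡[1+n]*nCk (suc n) (suc k) = begin
  k₂ ℕ.* (suc (suc n) C k₂)                                     ≡⟨ cong (k₂ ℕ.*_) (nCk+nC[k+1]≡[n+1]C[k+1] (suc n) k₁) ⟨
  k₂ ℕ.* ((suc n C k₁) ℕ.+ (suc n C k₂))                        ≡⟨ solve 3 (λ k a b → (con 1 :+ k) :* (a :+ b) := a :+ (k :* a :+ (con 1 :+ k) :* b)) refl k₁ (suc n C k₁) (suc n C k₂) ⟩
  (suc n C k₁) ℕ.+ (k₁ ℕ.* (suc n C k₁) ℕ.+ k₂ ℕ.* (suc n C k₂)) ≡⟨ cong ((suc n C k₁) ℕ.+_) (cong₂ ℕ._+_ ([1+k]*[1+n]C[1+k]≡[1+n]*nCk n k) ([1+k]*[1+n]C[1+k]≡[1+n]*nCk n k₁)) ⟩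
  (suc n C k₁) ℕ.+ (suc n ℕ.* (n C k) ℕ.+ suc n ℕ.* (n C k₁))   ≡⟨ cong ((suc n C k₁) ℕ.+_) (ℕ.*-distribˡ-+ (suc n) (n C k) (n C k₁)) ⟨
  (suc n C k₁) ℕ.+ suc n ℕ.* ((n C k) ℕ.+ (n C k₁))             ≡⟨ cong (λ c → (suc n C k₁) ℕ.+ suc n ℕ.* c) (nCk+nC[k+1]≡[n+1]C[k+1] n k) ⟩
  suc (suc n) ℕ.* (suc n C k₁)                                  ∎
  where
  open ≡-Reasoning
  open +-*-Solver
  k₁ = suc k
  k₂ = suc (suc k)

-- By absorption p divides `suc k * (p C suc k)`, and the first factor is positive and smaller than
-- p.
prime∣pCk : ∀ {p k} → Prime p → suc k ℕ.< p → p ∣ p C suc k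
prime∣pCk {zero}  pr _ = contradiction pr ¬prime[0]
prime∣pCk {suc n} {k} pr k<p
  with euclidsLemma (suc k) (suc n C suc k) pr
         (divides (n C k) (trans ([1+k]*[1+n]C[1+k]≡[1+n]*nCk n k) (ℕ.*-comm (suc n) (n C k))))
... | inj₁ p∣k = contradiction p∣k (>⇒∤ k<p)
... | inj₂ p∣C = p∣C

Odd : ℕ → Set
Odd n = ∃ λ k → n ≡ 1 ℕ.+ 2 ℕ.* k

even-or-odd : ∀ n → 2 ∣ n ⊎ Odd n
even-or-odd zero = inj₁ (divides 0 refl)
even-or-odd (suc n) with even-or-odd n
... | inj₁ (divides k eq) = inj₂ (k , cong suc (trans eq (ℕ.*-comm k 2)))
... | inj₂ (k , eq)       = inj₁ (divides (suc k) (cong suc (trans eq (cong suc (ℕ.*-comm 2 k)))))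

odd-* : ∀ {m n} → Odd m → Odd n → Odd (m ℕ.* n)
odd-* (a , refl) (b , refl) = a ℕ.+ b ℕ.+ 2 ℕ.* (a ℕ.* b) ,
  solve 2 (λ a b → (con 1 :+ con 2 :* a) :* (con 1 :+ con 2 :* b)
                     := con 1 :+ con 2 :* (a :+ b :+ con 2 :* (a :* b))) refl a b
  where open +-*-Solver

-- Half of the even part is left factored as `2 * j * suc j`. With Q² = 1 + 2j this is (Q² - 1) ·
-- (Q² + 1)/2, and Euler's criterion for elements of the subfield needs the factor Q² - 1 in sight.
[1+2j]² : ∀ j → (1 ℕ.+ 2 ℕ.* j) ℕ.* (1 ℕ.+ 2 ℕ.* j) ≡ 1 ℕ.+ 2 ℕ.* (2 ℕ.* j ℕ.* suc j)
[1+2j]² = solve 1 (λ j → (con 1 :+ con 2 :* j) :* (con 1 :+ con 2 :* j)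
                           := con 1 :+ con 2 :* (con 2 :* j :* (con 1 :+ j))) refl
  where open +-*-Solver

[1+2j]+1 : ∀ j → 1 ℕ.+ 2 ℕ.* j ℕ.+ 1 ≡ suc j ℕ.* 2
[1+2j]+1 = solve 1 (λ j → con 1 :+ con 2 :* j :+ con 1 := (con 1 :+ j) :* con 2) refl
  where open +-*-Solver

odd-^ : ∀ {m} k → Odd m → Odd (m ^ k)
odd-^ zero    _  = 0 , refl
odd-^ (suc k) om = odd-* om (odd-^ k om)

odd-prime : ∀ {p} → Prime p → p ≢ 2 → Odd p
odd-prime {p} pr p≢2 with even-or-odd p
... | inj₂ o = o
... | inj₁ 2∣p with prime⇒irreducible pr 2∣p
...   | inj₁ ()
...   | inj₂ 2≡p = contradiction (sym 2≡p) p≢2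

-- If j were missed, punching it out of the codomain would leave an injection of `Fin (suc n)` into
-- `Fin n`.
Fin-injective⇒surjective : ∀ {n} (f : Fin n → Fin n) → Injective _≡_ _≡_ f → ∀ j → ∃ λ i → f i ≡ j
Fin-injective⇒surjective {suc n} f inj j with Fin.any? (λ i → f i Fin.≟ j)
... | yes found = found
... | no ¬found = contradiction
        (λ {x} {y} eq → inj (Fin.punchOut-injective (j≢f x) (j≢f y) eq))
        (Fin.<⇒notInjective {f = λ i → punchOut (j≢f i)} (ℕ.n<1+n n))
  where
  j≢f : ∀ i → j ≢ f i
  j≢f i eq = ¬found (i , sym eq)

-- Ring solver with integer coefficients

module IntegerCoefficients {c ℓ} (R : CommutativeRing c ℓ) where
  open CommutativeRing R renaming (refl to ≈-refl; sym to ≈-sym; trans to ≈-trans)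
  open import Algebra.Properties.Ring ring
  open import Algebra.Properties.AbelianGroup +-abelianGroup using (⁻¹-∙-comm)
  open import Algebra.Properties.Semiring.Mult.TCOptimised semiring renaming (_×_ to _·_)
  open import Algebra.Solver.Ring.AlmostCommutativeRing using (fromCommutativeRing; _-Raw-AlmostCommutative⟶_)
  open import Relation.Binary.Reasoning.Setoid setoid

  fromℤ : ℤ → Carrier
  fromℤ (pos n)    = n · 1#
  fromℤ (-[1+ n ]) = - (suc n · 1#)

  fromℤ-⊖ : ∀ m n → fromℤ (m ⊖ n) ≈ m · 1# - n · 1#
  fromℤ-⊖ m       zero    = ≈-sym (≈-trans (+-congˡ -0#≈0#) (+-identityʳ _))
  fromℤ-⊖ zero    (suc n) = ≈-sym (+-identityˡ _)
  fromℤ-⊖ (suc m) (suc n) = begin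
    fromℤ (suc m ⊖ suc n)                ≡⟨ cong fromℤ (ℤ.[1+m]⊖[1+n]≡m⊖n m n) ⟩
    fromℤ (m ⊖ n)                        ≈⟨ fromℤ-⊖ m n ⟩
    m · 1# - n · 1#                      ≈⟨ +-congʳ (+-identityʳ _) ⟨
    (m · 1# + 0#) - n · 1#               ≈⟨ +-congʳ (+-congˡ (-‿inverseʳ 1#)) ⟨
    (m · 1# + (1# - 1#)) - n · 1#        ≈⟨ +-congʳ (+-assoc _ _ _) ⟨
    (m · 1# + 1# - 1#) - n · 1#          ≈⟨ +-assoc _ _ _ ⟩
    (m · 1# + 1#) + (- 1# - n · 1#)      ≈⟨ +-cong (≈-trans (+-comm _ _) (≈-sym (×-homo-+ 1# 1 m))) (≈-trans (⁻¹-∙-comm _ _) (-‿cong (≈-sym (×-homo-+ 1# 1 n)))) ⟩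
    suc m · 1# - suc n · 1#              ∎

  fromℤ-+ : ∀ i j → fromℤ (i ℤ.+ j) ≈ fromℤ i + fromℤ j
  fromℤ-+ (pos m)    (pos n)    = ×-homo-+ 1# m n
  fromℤ-+ (pos m)    (-[1+ n ]) = fromℤ-⊖ m (suc n)
  fromℤ-+ (-[1+ m ]) (pos n)    = ≈-trans (fromℤ-⊖ n (suc m)) (+-comm _ _)
  fromℤ-+ (-[1+ m ]) (-[1+ n ]) = begin
    - (suc (suc (m ℕ.+ n)) · 1#)         ≡⟨ cong (λ k → - (suc k · 1#)) (sym (ℕ.+-suc m n)) ⟩
    - ((suc m ℕ.+ suc n) · 1#)           ≈⟨ -‿cong (×-homo-+ 1# (suc m) (suc n)) ⟩
    - (suc m · 1# + suc n · 1#)          ≈⟨ ⁻¹-∙-comm _ _ ⟨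
    - (suc m · 1#) - (suc n · 1#)        ∎

  fromℤ-◃⁻ : ∀ n → fromℤ (Sign.- ◃ n) ≈ - (n · 1#)
  fromℤ-◃⁻ zero    = ≈-sym -0#≈0#
  fromℤ-◃⁻ (suc n) = ≈-refl

  fromℤ-◃⁺ : ∀ n → fromℤ (Sign.+ ◃ n) ≈ n · 1#
  fromℤ-◃⁺ zero    = ≈-refl
  fromℤ-◃⁺ (suc n) = ≈-refl

  fromℤ-* : ∀ i j → fromℤ (i ℤ.* j) ≈ fromℤ i * fromℤ j
  fromℤ-* (pos m)    (pos n)    = ≈-trans (fromℤ-◃⁺ (m ℕ.* n)) (×1-homo-* m n)
  fromℤ-* (pos m)    (-[1+ n ]) = ≈-trans (fromℤ-◃⁻ (m ℕ.* suc n)) (≈-trans (-‿cong (×1-homo-* m (suc n))) (-‿distribʳ-* _ _))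
  fromℤ-* (-[1+ m ]) (pos n)    = ≈-trans (fromℤ-◃⁻ (suc m ℕ.* n)) (≈-trans (-‿cong (×1-homo-* (suc m) n)) (-‿distribˡ-* _ _))
  fromℤ-* (-[1+ m ]) (-[1+ n ]) = begin
    (suc m ℕ.* suc n) · 1#               ≈⟨ ×1-homo-* (suc m) (suc n) ⟩
    (suc m · 1#) * (suc n · 1#)          ≈⟨ -‿involutive _ ⟨
    - - ((suc m · 1#) * (suc n · 1#))    ≈⟨ -‿cong (-‿distribʳ-* _ _) ⟩
    - ((suc m · 1#) * - (suc n · 1#))    ≈⟨ -‿distribˡ-* _ _ ⟩
    - (suc m · 1#) * - (suc n · 1#)      ∎

  fromℤ-neg : ∀ i → fromℤ (ℤ.- i) ≈ - fromℤ i
  fromℤ-neg (pos zero)    = ≈-sym -0#≈0#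
  fromℤ-neg (pos (suc n)) = ≈-refl
  fromℤ-neg (-[1+ n ])    = ≈-sym (-‿involutive _)

  fromℤ-morphism : ℤ.+-*-rawRing -Raw-AlmostCommutative⟶ fromCommutativeRing R
  fromℤ-morphism = record
    { ⟦_⟧ = fromℤ ; +-homo = fromℤ-+ ; *-homo = fromℤ-* ; -‿homo = fromℤ-neg
    ; 0-homo = ≈-refl ; 1-homo = ≈-refl }

  -- Coefficients are compared in ℤ, because equality in R need not be decidable; `nothing` only
  -- means that no identification is made.
  coefficient≟ : ∀ i j → Maybe (fromℤ i ≈ fromℤ j)
  coefficient≟ i j with i ℤ.≟ j
  ... | yes i≡j = just (reflexive (cong fromℤ i≡j))
  ... | no _    = nothing

  open import Algebra.Solver.Ring ℤ.+-*-rawRing (fromCommutativeRing R) fromℤ-morphism coefficient≟ public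

-- Fields

module FieldTheory (F : Field) where
  open Field F renaming (_^_ to infixr 8 _^ᶠ_)

  commutativeRing : CommutativeRing _ _
  commutativeRing = record { isCommutativeRing = isCommutativeRing }

  open CommutativeRing commutativeRing public
    using (+-assoc; +-comm; +-identityˡ; +-identityʳ; -‿inverseʳ; -‿inverseˡ; *-assoc; *-comm
          ; *-identityˡ; *-identityʳ; zeroˡ; zeroʳ; semiring; commutativeSemiring
          ; ring; +-commutativeMonoid; *-commutativeMonoid)
  open import Algebra.Properties.Ring ring public using (-0#≈0#; -‿involutive; x∙y⁻¹≈ε⇒x≈y)
  open IntegerCoefficients commutativeRing public

  x-x≡0 : ∀ x → x - x ≡ 0#
  x-x≡0 = -‿inverseʳ

  *-cancelˡ-nonZero : ∀ {x y z} → x ≢ 0# → x * y ≡ x * z → y ≡ z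
  *-cancelˡ-nonZero {x} {y} {z} x≢0 eq = begin
    y                ≡⟨ *-identityˡ y ⟨
    1# * y           ≡⟨ cong (_* y) (inverse) ⟨
    x ⁻¹ * x * y     ≡⟨ *-assoc (x ⁻¹) x y ⟩
    x ⁻¹ * (x * y)   ≡⟨ cong (x ⁻¹ *_) eq ⟩
    x ⁻¹ * (x * z)   ≡⟨ *-assoc (x ⁻¹) x z ⟨
    x ⁻¹ * x * z     ≡⟨ cong (_* z) (inverse) ⟩
    1# * z           ≡⟨ *-identityˡ z ⟩
    z                ∎
    where
    open ≡-Reasoning
    inverse : x ⁻¹ * x ≡ 1#
    inverse = trans (*-comm (x ⁻¹) x) (inverseʳ x x≢0)

  x≢0∧xy≡0⇒y≡0 : ∀ {x y} → x ≢ 0# → x * y ≡ 0# → y ≡ 0#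
  x≢0∧xy≡0⇒y≡0 x≢0 eq = *-cancelˡ-nonZero x≢0 (trans eq (sym (zeroʳ _)))

  *-nonZero : ∀ {x y} → x ≢ 0# → y ≢ 0# → x * y ≢ 0#
  *-nonZero x≢0 y≢0 eq = y≢0 (x≢0∧xy≡0⇒y≡0 x≢0 eq)

  /-*-cancel : ∀ {d} → d ≢ 0# → ∀ n → n * d ⁻¹ * d ≡ n
  /-*-cancel {d} d≢0 n = trans (*-assoc n (d ⁻¹) d)
    (trans (cong (n *_) (trans (*-comm (d ⁻¹) d) (inverseʳ d d≢0))) (*-identityʳ n))

  ^-homo-* : ∀ x m n → x ^ᶠ (m ℕ.+ n) ≡ x ^ᶠ m * x ^ᶠ n
  ^-homo-* x zero    n = sym (*-identityˡ _)
  ^-homo-* x (suc m) n = trans (cong (x *_) (^-homo-* x m n)) (sym (*-assoc x _ _))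

  ^-distrib-* : ∀ x y n → (x * y) ^ᶠ n ≡ x ^ᶠ n * y ^ᶠ n
  ^-distrib-* x y zero    = sym (*-identityˡ 1#)
  ^-distrib-* x y (suc n) = trans (cong (x * y *_) (^-distrib-* x y n))
    (solve 4 (λ x y a b → x :* y :* (a :* b) := x :* a :* (y :* b)) refl x y (x ^ᶠ n) (y ^ᶠ n))

  1^n≡1 : ∀ n → 1# ^ᶠ n ≡ 1#
  1^n≡1 zero    = refl
  1^n≡1 (suc n) = trans (*-identityˡ _) (1^n≡1 n)

  ^-assocʳ : ∀ x m n → (x ^ᶠ m) ^ᶠ n ≡ x ^ᶠ (m ℕ.* n)
  ^-assocʳ x zero    n = 1^n≡1 n
  ^-assocʳ x (suc m) n = trans (^-distrib-* x (x ^ᶠ m) n)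
    (trans (cong (x ^ᶠ n *_) (^-assocʳ x m n)) (sym (^-homo-* x n (m ℕ.* n))))

  0^n≡0 : ∀ {n} → n ≢ 0 → 0# ^ᶠ n ≡ 0#
  0^n≡0 {zero}  n≢0 = contradiction refl n≢0
  0^n≡0 {suc n} _   = zeroˡ _

  ^-nonZero : ∀ {x} n → x ≢ 0# → x ^ᶠ n ≢ 0#
  ^-nonZero zero    _   eq = 0≢1 (sym eq)
  ^-nonZero (suc n) x≢0 eq = *-nonZero x≢0 (^-nonZero n x≢0) eq

  fromℕ-+ : ∀ m n → fromℕ (m ℕ.+ n) ≡ fromℕ m + fromℕ n
  fromℕ-+ zero    n = sym (+-identityˡ _)
  fromℕ-+ (suc m) n = trans (cong (1# +_) (fromℕ-+ m n)) (sym (+-assoc 1# _ _))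

  fromℕ-* : ∀ m n → fromℕ (m ℕ.* n) ≡ fromℕ m * fromℕ n
  fromℕ-* zero    n = sym (zeroˡ _)
  fromℕ-* (suc m) n = begin
    fromℕ (n ℕ.+ m ℕ.* n)              ≡⟨ fromℕ-+ n (m ℕ.* n) ⟩
    fromℕ n + fromℕ (m ℕ.* n)          ≡⟨ cong (fromℕ n +_) (fromℕ-* m n) ⟩
    fromℕ n + fromℕ m * fromℕ n        ≡⟨ solve 2 (λ m n → n :+ m :* n := (con (pos 1) :+ m) :* n) refl (fromℕ m) (fromℕ n) ⟩
    (1# + fromℕ m) * fromℕ n           ∎
    where open ≡-Reasoning

  fromℕ-^ : ∀ m n → fromℕ (m ^ n) ≡ fromℕ m ^ᶠ n
  fromℕ-^ m zero    = +-identityʳ 1#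
  fromℕ-^ m (suc n) = trans (fromℕ-* m (m ^ n)) (cong (fromℕ m *_) (fromℕ-^ m n))

  -- A vector c₀ ∷ … ∷ cₙ₋₁ stands for the monic polynomial Xⁿ + cₙ₋₁ Xⁿ⁻¹ + … + c₀.
  evalMonic : ∀ {n} → Vec Carrier n → Carrier → Carrier
  evalMonic []       x = 1#
  evalMonic (c ∷ cs) x = c + x * evalMonic cs x

  -- Synthetic division: each coefficient of the quotient is the value at a of a tail of the
  -- polynomial, and the remainder is the value of the whole. The quotient stays monic, so no
  -- leading coefficient has to be tracked.
  evalMonic-factor : ∀ {n} (cs : Vec Carrier (suc n)) a → Σ (Vec Carrier n) λ ds →
    ∀ x → evalMonic cs x ≡ (x - a) * evalMonic ds x + evalMonic cs a
  evalMonic-factor (c ∷ []) a = [] , λ x →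
    solve 3 (λ c x a → c :+ x :* con (pos 1) := (x :- a) :* con (pos 1) :+ (c :+ a :* con (pos 1))) refl c x a
  evalMonic-factor (c ∷ cs@(_ ∷ _)) a with evalMonic-factor cs a
  ... | ds , factor = evalMonic cs a ∷ ds , λ x → trans (cong (λ e → c + x * e) (factor x))
    (solve 5 (λ c x a e r → c :+ x :* ((x :- a) :* e :+ r) := (x :- a) :* (r :+ x :* e) :+ (c :+ a :* r)) refl
      c x a (evalMonic ds x) (evalMonic cs a))

  monic-root-bound : ∀ {n} (cs : Vec Carrier n) (root : Fin (suc n) → Carrier) → Injective _≡_ _≡_ root →
    ¬ (∀ i → evalMonic cs (root i) ≡ 0#)
  monic-root-bound []         root inj vanish = 0≢1 (sym (vanish fzero))
  monic-root-bound cs@(_ ∷ _) root inj vanish with evalMonic-factor cs (root fzero)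
  ... | ds , factor = monic-root-bound ds (root ∘ fsuc) (Fin.suc-injective ∘ inj) λ i →
    x≢0∧xy≡0⇒y≡0 (λ eq → contradiction (inj (x∙y⁻¹≈ε⇒x≈y _ _ eq)) λ ()) (begin
      (root (fsuc i) - root fzero) * evalMonic ds (root (fsuc i))         ≡⟨ +-identityʳ _ ⟨
      (root (fsuc i) - root fzero) * evalMonic ds (root (fsuc i)) + 0#    ≡⟨ cong ((root (fsuc i) - root fzero) * evalMonic ds (root (fsuc i)) +_) (vanish fzero) ⟨
      (root (fsuc i) - root fzero) * evalMonic ds (root (fsuc i)) + evalMonic cs (root fzero) ≡⟨ factor _ ⟨
      evalMonic cs (root (fsuc i))                                        ≡⟨ vanish (fsuc i) ⟩
      0#                                                                  ∎)
    where open ≡-Reasoning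

  evalMonic-power : ∀ n x → evalMonic (replicate n 0#) x ≡ x ^ᶠ n
  evalMonic-power zero    x = refl
  evalMonic-power (suc n) x = trans (+-identityˡ _) (cong (x *_) (evalMonic-power n x))

  module DecidableField (_≟_ : DecidableEquality Carrier) where

    xy≡0⇒x≡0∨y≡0 : ∀ {x y} → x * y ≡ 0# → x ≡ 0# ⊎ y ≡ 0#
    xy≡0⇒x≡0∨y≡0 {x} eq with x ≟ 0#
    ... | yes x≡0 = inj₁ x≡0
    ... | no  x≢0 = inj₂ (x≢0∧xy≡0⇒y≡0 x≢0 eq)

    x²≡y²⇒x≡±y : ∀ {x y} → x * x ≡ y * y → x ≡ y ⊎ x ≡ - y
    x²≡y²⇒x≡±y {x} {y} eq
      with xy≡0⇒x≡0∨y≡0 {x - y} {x + y}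
             (trans (solve 2 (λ x y → (x :- y) :* (x :+ y) := x :* x :- y :* y) refl x y)
                    (trans (cong (_- y * y) eq) (x-x≡0 _)))
    ... | inj₁ x-y≡0 = inj₁ (x∙y⁻¹≈ε⇒x≈y _ _ x-y≡0)
    ... | inj₂ x+y≡0 = inj₂ (x∙y⁻¹≈ε⇒x≈y _ _
           (trans (solve 2 (λ x y → x :- :- y := x :+ y) refl x y) x+y≡0))

    x^n≡0⇒x≡0 : ∀ {x} n → x ^ᶠ n ≡ 0# → x ≡ 0#
    x^n≡0⇒x≡0 {x} n eq with x ≟ 0#
    ... | yes x≡0 = x≡0
    ... | no  x≢0 = contradiction eq (^-nonZero n x≢0)

-- The fibres of X ↦ (X^{2Q+1} − X^{Q+1} + 1) / (X^{2Q+1} − X^Q + 1)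

record IsEndomorphism (F : Field) (φ : Field.Carrier F → Field.Carrier F) : Set where
  open Field F
  field
    φ-+ : ∀ x y → φ (x + y) ≡ φ x + φ y
    φ-* : ∀ x y → φ (x * y) ≡ φ x * φ y
    φ-1 : φ 1# ≡ 1#

module Endomorphism (F : Field) (_≟_ : DecidableEquality (Field.Carrier F))
  (φ : Field.Carrier F → Field.Carrier F) (isEndomorphism : IsEndomorphism F φ) where

  open Field F hiding (_^_)
  open IsEndomorphism isEndomorphism
  open FieldTheory F
  open DecidableField _≟_
  open import Algebra.Properties.Semiring.Exp semiring using () renaming (_^_ to infixr 8 _^ˢ_)
  open import Algebra.Properties.Semiring.Mult.TCOptimised semiring using () renaming (_×_ to _·_)
  open import Algebra.Properties.Group (CommutativeRing.+-group commutativeRing) using (identityˡ-unique; inverseˡ-unique)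

  φ-0 : φ 0# ≡ 0#
  φ-0 = identityˡ-unique (φ 0#) (φ 0#) (trans (sym (φ-+ 0# 0#)) (cong φ (+-identityˡ 0#)))

  φ-neg : ∀ x → φ (- x) ≡ - φ x
  φ-neg x = inverseˡ-unique (φ (- x)) (φ x) (trans (sym (φ-+ (- x) x)) (trans (cong φ (-‿inverseˡ x)) φ-0))

  φ-- : ∀ x y → φ (x - y) ≡ φ x - φ y
  φ-- x y = trans (φ-+ x (- y)) (cong (φ x +_) (φ-neg y))

  φ-· : ∀ n → φ (n · 1#) ≡ n · 1#
  φ-· zero          = φ-0
  φ-· (suc zero)    = φ-1
  φ-· (suc (suc n)) = trans (φ-+ _ _) (cong₂ _+_ (φ-· (suc n)) φ-1)

  φ-fromℤ : ∀ i → φ (fromℤ i) ≡ fromℤ i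
  φ-fromℤ (pos n)    = φ-· n
  φ-fromℤ (-[1+ n ]) = trans (φ-neg _) (cong -_ (φ-· (suc n)))

  φ-^ˢ : ∀ x n → φ (x ^ˢ n) ≡ φ x ^ˢ n
  φ-^ˢ x zero    = φ-1
  φ-^ˢ x (suc n) = trans (φ-* x (x ^ˢ n)) (cong (φ x *_) (φ-^ˢ x n))

  -- Integer coefficients are fixed by φ, so φ passes through every polynomial expression. Relations
  -- that also exist as solver syntax can thus be transformed by φ as a whole.
  φ-⟦_⟧ : ∀ {n} (p : Polynomial n) ρ → φ (⟦ p ⟧ ρ) ≡ ⟦ p ⟧ (Vec.map φ ρ)
  φ-⟦ op [+] p q ⟧ ρ = trans (φ-+ _ _) (cong₂ _+_ (φ-⟦ p ⟧ ρ) (φ-⟦ q ⟧ ρ))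
  φ-⟦ op [*] p q ⟧ ρ = trans (φ-* _ _) (cong₂ _*_ (φ-⟦ p ⟧ ρ) (φ-⟦ q ⟧ ρ))
  φ-⟦ con c ⟧      ρ = φ-fromℤ c
  φ-⟦ var i ⟧      ρ = sym (Vec.lookup-map i φ ρ)
  φ-⟦ p :^ n ⟧     ρ = trans (φ-^ˢ (⟦ p ⟧ ρ) n) (cong (_^ˢ n) (φ-⟦ p ⟧ ρ))
  φ-⟦ :- p ⟧       ρ = trans (φ-neg _) (cong -_ (φ-⟦ p ⟧ ρ))

  private
    𝟙 : ∀ {n} → Polynomial n
    𝟙 = con (pos 1)

  numerator denominator : Carrier → Carrier → Carrier
  numerator   z Z = z * Z * Z - z * Z + 1#
  denominator z Z = z * Z * Z - Z + 1#

  num den : ∀ {n} → Polynomial n → Polynomial n → Polynomial n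
  num z Z = z :* Z :* Z :- z :* Z :+ 𝟙
  den z Z = z :* Z :* Z :- Z :+ 𝟙

  -- With Z and Y the images of z and y under φ, fibre z Z y Y vanishes iff z and y lie in the same
  -- fibre, and fibre′ is its image under φ.  Generically the fibre is a pentagon, and A and B vanish
  -- on its adjacent and its diagonal pairs of vertices respectively.
  A B fibre fibre′ : (z Z y Y : Carrier) → Carrier
  A      z Z y Y = Y - y * Y - Z * Y - z * y + z * y * Y
  B      z Z y Y = 1# - y + Z * y - Z * y * Y + z * Z * y * Y
  fibre  z Z y Y = Z * (z - 1#) * numerator y Y - Y * (y - 1#) * numerator z Z
  fibre′ z Z y Y = z * (1# - Z) * (Y - y + y * y) - y * (1# - Y) * (Z - z + z * z)

  A′ B′ fib fib′ : ∀ {n} (z Z y Y : Polynomial n) → Polynomial n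
  A′   z Z y Y = Y :- y :* Y :- Z :* Y :- z :* y :+ z :* y :* Y
  B′   z Z y Y = 𝟙 :- y :+ Z :* y :- Z :* y :* Y :+ z :* Z :* y :* Y
  fib  z Z y Y = Z :* (z :- 𝟙) :* num y Y :- Y :* (y :- 𝟙) :* num z Z
  fib′ z Z y Y = z :* (𝟙 :- Z) :* (Y :- y :+ y :* y) :- y :* (𝟙 :- Y) :* (Z :- z :+ z :* z)

  fibre-AB : ∀ z Z y Y → (z - y) * (A z Z y Y * B z Z y Y)
    ≡ (y * y - y - z * y * y) * fibre z Z y Y + (1# - y - Z * y * Y + z * Z * y * Y) * fibre′ z Z y Y
  fibre-AB = solve 4 (λ z Z y Y → (z :- y) :* (A′ z Z y Y :* B′ z Z y Y)
    := (y :* y :- y :- z :* y :* y) :* fib z Z y Y :+ (𝟙 :- y :- Z :* y :* Y :+ z :* Z :* y :* Y) :* fib′ z Z y Y) refl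

  adjacent∧diagonal : ∀ z Z y Y → (z + Z * Y) * (y + Z * Y)
    ≡ - (1# + Z * Y) * A z Z y Y - Y * A y Y z Z + Y * B z Z y Y
  adjacent∧diagonal = solve 4 (λ z Z y Y → (z :+ Z :* Y) :* (y :+ Z :* Y)
    := :- (𝟙 :+ Z :* Y) :* A′ z Z y Y :- Y :* A′ y Y z Z :+ Y :* B′ z Z y Y) refl

  -- Modulo A(z, y) and B(y, z), the difference is a combination of z + ZY and 1 + Zzy. The second
  -- is zy times the image Z + 1/(zy) of the first under φ, so both vanish together.
  difference : ∀ z Z y Y → y - z
    ≡ - A z Z y Y + y * B y Y z Z - (z + Z * Y) + (Y - y * Y) * (1# + Z * z * y)
  difference = solve 4 (λ z Z y Y → y :- z
    := :- A′ z Z y Y :+ y :* B′ y Y z Z :- (z :+ Z :* Y) :+ (Y :- y :* Y) :* (𝟙 :+ Z :* z :* y)) refl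

  -- For φ x = x^Q this says that z is a (Q² + 1)-th root of unity.
  Unit : Carrier → Set
  Unit z = z * φ (φ z) ≡ 1#

  unit⇒nonZero : ∀ {z} → Unit z → z ≢ 0#
  unit⇒nonZero uz refl = 0≢1 (trans (sym (zeroˡ _)) uz)

  unit-φ : ∀ {z} → Unit z → Unit (φ z)
  unit-φ {z} uz = trans (sym (φ-* z (φ (φ z)))) (trans (cong φ uz) φ-1)

  module _ {z y : Carrier} (uz : Unit z) (uy : Unit y) where
    private
      Z = φ z
      w = φ Z
      Y = φ y
      v = φ Y
      ρ : Vec Carrier 4
      ρ = z ∷ Z ∷ y ∷ Y ∷ []
      x₀ x₁ x₂ x₃ : Polynomial 4
      x₀ = var fzero
      x₁ = var (fsuc fzero)
      x₂ = var (fsuc (fsuc fzero))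
      x₃ = var (fsuc (fsuc (fsuc fzero)))

      -- Applies φ to the relation p(z, Z, y, Y) = 0, clears the denominators z and y of w = 1/z and
      -- v = 1/y by the factor m, and then replaces the arguments z w and y v of G by 1.
      transport : ∀ (p : Polynomial 4) m (G : Carrier → Carrier → Carrier) {r} →
        m * ⟦ p ⟧ (Z ∷ w ∷ Y ∷ v ∷ []) ≡ G (z * w) (y * v) → G 1# 1# ≡ r → ⟦ p ⟧ ρ ≡ 0# → r ≡ 0#
      transport p m G {r} clear simplify p≡0 = begin
        r                                   ≡⟨ simplify ⟨
        G 1# 1#                             ≡⟨ cong₂ G uz uy ⟨
        G (z * w) (y * v)                   ≡⟨ clear ⟨
        m * ⟦ p ⟧ (Z ∷ w ∷ Y ∷ v ∷ [])      ≡⟨ cong (m *_) (φ-⟦ p ⟧ ρ) ⟨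
        m * φ (⟦ p ⟧ ρ)                     ≡⟨ cong (λ a → m * φ a) p≡0 ⟩
        m * φ 0#                            ≡⟨ cong (m *_) φ-0 ⟩
        m * 0#                              ≡⟨ zeroʳ m ⟩
        0#                                  ∎
        where open ≡-Reasoning

    -- Substituting (Z, 1/z, Y, 1/y) into A and multiplying by -zy yields B with the two points
    -- exchanged, whereas `B⇒A` keeps their order. So φ runs through A(z, y), B(y, z), A(y, z), B(z,
    -- y) in a cycle.
    A⇒B : A z Z y Y ≡ 0# → B y Y z Z ≡ 0#
    A⇒B = transport (A′ x₀ x₁ x₂ x₃) (- (z * y))
      (λ o q → o * q + z * y * (Z * Y) - z * q + z * Y * q - z * Z * Y * q)
      (solve 6 (λ z Z y Y w v → :- (z :* y) :* A′ Z w Y v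
        := (z :* w) :* (y :* v) :+ z :* y :* (Z :* Y) :- z :* (y :* v) :+ z :* Y :* (y :* v) :- z :* Z :* Y :* (y :* v)) refl z Z y Y w v)
      (solve 4 (λ z Z y Y → 𝟙 :* 𝟙 :+ z :* y :* (Z :* Y) :- z :* 𝟙 :+ z :* Y :* 𝟙 :- z :* Z :* Y :* 𝟙
        := B′ y Y z Z) refl z Z y Y)

    B⇒A : B z Z y Y ≡ 0# → A z Z y Y ≡ 0#
    B⇒A = transport (B′ x₀ x₁ x₂ x₃) (- (z * y))
      (λ o q → z * y * Y - z * y - o * y * Y + o * q * Y - o * q * Z * Y)
      (solve 6 (λ z Z y Y w v → :- (z :* y) :* B′ Z w Y v
        := z :* y :* Y :- z :* y :- (z :* w) :* y :* Y :+ (z :* w) :* (y :* v) :* Y :- (z :* w) :* (y :* v) :* Z :* Y) refl z Z y Y w v)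
      (solve 4 (λ z Z y Y → z :* y :* Y :- z :* y :- 𝟙 :* y :* Y :+ 𝟙 :* 𝟙 :* Y :- 𝟙 :* 𝟙 :* Z :* Y
        := A′ z Z y Y) refl z Z y Y)

    -- Substitution produces Y - yY + y² where `fibre′` has Y - y + y², and similarly for z. Passing
    -- from one form to the other changes both products by the same multiple of zy(1 - Z)(1 - Y).
    -- The chosen form is the one that part (b) delivers.
    fibre⇒fibre′ : fibre z Z y Y ≡ 0# → fibre′ z Z y Y ≡ 0#
    fibre⇒fibre′ = transport (fib x₀ x₁ x₂ x₃) (- (z * z * (y * y)))
      (λ o q → y * q * (Y - 1#) * (Z * o * o - Z * z * o + z * z) - z * o * (Z - 1#) * (Y * q * q - Y * y * q + y * y))
      (solve 6 (λ z Z y Y w v → :- (z :* z :* (y :* y)) :* fib Z w Y v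
        := y :* (y :* v) :* (Y :- 𝟙) :* (Z :* (z :* w) :* (z :* w) :- Z :* z :* (z :* w) :+ z :* z)
           :- z :* (z :* w) :* (Z :- 𝟙) :* (Y :* (y :* v) :* (y :* v) :- Y :* y :* (y :* v) :+ y :* y)) refl z Z y Y w v)
      (solve 4 (λ z Z y Y → y :* 𝟙 :* (Y :- 𝟙) :* (Z :* 𝟙 :* 𝟙 :- Z :* z :* 𝟙 :+ z :* z)
           :- z :* 𝟙 :* (Z :- 𝟙) :* (Y :* 𝟙 :* 𝟙 :- Y :* y :* 𝟙 :+ y :* y)
        := fib′ z Z y Y) refl z Z y Y)

    fibre′⇒fibre : fibre′ z Z y Y ≡ 0# → fibre z Z y Y ≡ 0#
    fibre′⇒fibre = transport (fib′ x₀ x₁ x₂ x₃) (z * y)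
      (λ o q → Z * (z - o) * (q - y * Y + y * Y * Y) - Y * (y - q) * (o - z * Z + z * Z * Z))
      (solve 6 (λ z Z y Y w v → (z :* y) :* fib′ Z w Y v
        := Z :* (z :- z :* w) :* (y :* v :- y :* Y :+ y :* Y :* Y) :- Y :* (y :- y :* v) :* (z :* w :- z :* Z :+ z :* Z :* Z)) refl z Z y Y w v)
      (solve 4 (λ z Z y Y → Z :* (z :- 𝟙) :* (𝟙 :- y :* Y :+ y :* Y :* Y) :- Y :* (y :- 𝟙) :* (𝟙 :- z :* Z :+ z :* Z :* Z)
        := fib z Z y Y) refl z Z y Y)

    z+ZY≡0⇒1+Zzy≡0 : z + Z * Y ≡ 0# → 1# + Z * z * y ≡ 0#
    z+ZY≡0⇒1+Zzy≡0 = transport (x₀ :+ x₁ :* x₃) (z * y)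
      (λ o q → o * q + Z * z * y)
      (solve 6 (λ z Z y Y w v → (z :* y) :* (Z :+ w :* v) := (z :* w) :* (y :* v) :+ Z :* z :* y) refl z Z y Y w v)
      (solve 3 (λ z Z y → 𝟙 :* 𝟙 :+ Z :* z :* y := 𝟙 :+ Z :* z :* y) refl z Z y)

  degenerate : ∀ {z y} → Unit z → Unit y → A z (φ z) y (φ y) ≡ 0# → B y (φ y) z (φ z) ≡ 0# →
    z + φ z * φ y ≡ 0# → z ≡ y
  degenerate {z} {y} uz uy a b c = sym (x∙y⁻¹≈ε⇒x≈y y z (begin
    y - z                       ≡⟨ difference z (φ z) y (φ y) ⟩
    - A z (φ z) y (φ y) + y * B y (φ y) z (φ z) - (z + φ z * φ y) + (φ y - y * φ y) * (1# + φ z * z * y)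
                                ≡⟨ cong₂ _+_ (cong₂ _-_ (cong₂ (λ a b → - a + y * b) a b) c) (cong ((φ y - y * φ y) *_) (z+ZY≡0⇒1+Zzy≡0 uz uy c)) ⟩
    - 0# + y * 0# - 0# + (φ y - y * φ y) * 0#
                                ≡⟨ solve 2 (λ y Y → :- con (pos 0) :+ y :* con (pos 0) :- con (pos 0) :+ (Y :- y :* Y) :* con (pos 0) := con (pos 0)) refl y (φ y) ⟩
    0#                          ∎))
    where open ≡-Reasoning

  -- One vanishing relation gives all four around the cycle of φ, among them the three that
  -- `adjacent∧diagonal` combines. Exchanging z and y exchanges its two factors.
  A≡0⇒z≡y : ∀ {z y} → Unit z → Unit y → A z (φ z) y (φ y) ≡ 0# → z ≡ y
  A≡0⇒z≡y {z} {y} uz uy a = split (xy≡0⇒x≡0∨y≡0 (begin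
    (z + φ z * φ y) * (y + φ z * φ y)  ≡⟨ adjacent∧diagonal z (φ z) y (φ y) ⟩
    - (1# + φ z * φ y) * A z (φ z) y (φ y) - φ y * A y (φ y) z (φ z) + φ y * B z (φ z) y (φ y)
                                       ≡⟨ cong₂ _+_ (cong₂ (λ a ã → - (1# + φ z * φ y) * a - φ y * ã) a ã) (cong (φ y *_) b) ⟩
    - (1# + φ z * φ y) * 0# - φ y * 0# + φ y * 0#
                                       ≡⟨ solve 2 (λ Z Y → :- (𝟙 :+ Z :* Y) :* con (pos 0) :- Y :* con (pos 0) :+ Y :* con (pos 0) := con (pos 0)) refl (φ z) (φ y) ⟩
    0#                                 ∎))
    where
    open ≡-Reasoning
    b̃ : B y (φ y) z (φ z) ≡ 0#
    b̃ = A⇒B uz uy a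
    ã : A y (φ y) z (φ z) ≡ 0#
    ã = B⇒A uy uz b̃
    b : B z (φ z) y (φ y) ≡ 0#
    b = A⇒B uy uz ã
    split : z + φ z * φ y ≡ 0# ⊎ y + φ z * φ y ≡ 0# → z ≡ y
    split (inj₁ c) = degenerate uz uy a b̃ c
    split (inj₂ c) = sym (degenerate uy uz ã b (trans (cong (y +_) (*-comm (φ y) (φ z))) c))

  fibre-injective : ∀ {z y} → Unit z → Unit y → fibre z (φ z) y (φ y) ≡ 0# → z ≡ y
  fibre-injective {z} {y} uz uy f = split (xy≡0⇒x≡0∨y≡0 (begin
    (z - y) * (A z (φ z) y (φ y) * B z (φ z) y (φ y))  ≡⟨ fibre-AB z (φ z) y (φ y) ⟩
    c₁ * fibre z (φ z) y (φ y) + c₂ * fibre′ z (φ z) y (φ y)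
                                                       ≡⟨ cong₂ (λ f f′ → c₁ * f + c₂ * f′) f (fibre⇒fibre′ uz uy f) ⟩
    c₁ * 0# + c₂ * 0#                                  ≡⟨ solve 2 (λ a b → a :* con (pos 0) :+ b :* con (pos 0) := con (pos 0)) refl c₁ c₂ ⟩
    0#                                                 ∎))
    where
    open ≡-Reasoning
    c₁ c₂ : Carrier
    c₁ = y * y - y - z * y * y
    c₂ = 1# - y - φ z * y * φ y + z * φ z * y * φ y
    split′ : A z (φ z) y (φ y) ≡ 0# ⊎ B z (φ z) y (φ y) ≡ 0# → z ≡ y
    split′ (inj₁ a) = A≡0⇒z≡y uz uy a
    split′ (inj₂ b) = A≡0⇒z≡y uz uy (B⇒A uz uy b)
    split : z - y ≡ 0# ⊎ A z (φ z) y (φ y) * B z (φ z) y (φ y) ≡ 0# → z ≡ y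
    split (inj₁ z-y≡0) = x∙y⁻¹≈ε⇒x≈y z y z-y≡0
    split (inj₂ ab≡0)  = split′ (xy≡0⇒x≡0∨y≡0 ab≡0)

  -- The map of part (c) on roots of unity

  private
    swap-num-den : ∀ {z} → Unit z → (p r : Polynomial 2) (G : Carrier → Carrier → Carrier) →
      (z * φ z * φ z) * ⟦ p ⟧ (φ (φ z) ∷ φ (φ (φ z)) ∷ []) ≡ G (z * φ (φ z)) (φ z * φ (φ (φ z))) →
      G 1# 1# ≡ ⟦ r ⟧ (z ∷ φ z ∷ []) →
      (z * φ z * φ z) * φ (φ (⟦ p ⟧ (z ∷ φ z ∷ []))) ≡ ⟦ r ⟧ (z ∷ φ z ∷ [])
    swap-num-den {z} uz p r G clear simplify =
      trans (cong (z * φ z * φ z *_) (trans (cong φ (φ-⟦ p ⟧ _)) (φ-⟦ p ⟧ _)))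
        (trans clear (trans (cong₂ G uz (unit-φ uz)) simplify))

  -- φ² inverts z and Z, so after clearing by zZ² the order of the coefficients is reversed, and
  -- numerator and denominator are reversals of each other. Hence φ² inverts `ratio z`.
  φ²-numerator : ∀ {z} → Unit z → (z * φ z * φ z) * φ (φ (numerator z (φ z))) ≡ denominator z (φ z)
  φ²-numerator {z} uz = swap-num-den uz (num (var fzero) (var (fsuc fzero))) (den (var fzero) (var (fsuc fzero)))
    (λ o q → o * q * q - o * q * φ z + z * φ z * φ z)
    (solve 4 (λ z Z w W → (z :* Z :* Z) :* num w W
      := (z :* w) :* (Z :* W) :* (Z :* W) :- (z :* w) :* (Z :* W) :* Z :+ z :* Z :* Z) refl z (φ z) (φ (φ z)) (φ (φ (φ z))))
    (solve 2 (λ z Z → 𝟙 :* 𝟙 :* 𝟙 :- 𝟙 :* 𝟙 :* Z :+ z :* Z :* Z := den z Z) refl z (φ z))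

  φ²-denominator : ∀ {z} → Unit z → (z * φ z * φ z) * φ (φ (denominator z (φ z))) ≡ numerator z (φ z)
  φ²-denominator {z} uz = swap-num-den uz (den (var fzero) (var (fsuc fzero))) (num (var fzero) (var (fsuc fzero)))
    (λ o q → o * q * q - z * φ z * q + z * φ z * φ z)
    (solve 4 (λ z Z w W → (z :* Z :* Z) :* den w W
      := (z :* w) :* (Z :* W) :* (Z :* W) :- z :* Z :* (Z :* W) :+ z :* Z :* Z) refl z (φ z) (φ (φ z)) (φ (φ (φ z))))
    (solve 2 (λ z Z → 𝟙 :* 𝟙 :* 𝟙 :- z :* Z :* 𝟙 :+ z :* Z :* Z := num z Z) refl z (φ z))

  -- If the denominator vanishes, so does its reversal, the numerator. Their difference Z(z - 1)
  -- then leaves only z = 1, where the denominator is 1.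
  denominator≢0 : ∀ {z} → Unit z → denominator z (φ z) ≢ 0#
  denominator≢0 {z} uz d≡0 = 0≢1 (begin
    0#                                  ≡⟨ d≡0 ⟨
    denominator z (φ z)                 ≡⟨ cong₂ denominator z≡1 (trans (cong φ z≡1) φ-1) ⟩
    denominator 1# 1#                   ≡⟨ solve 0 (den 𝟙 𝟙 := 𝟙) refl ⟩
    1#                                  ∎)
    where
    open ≡-Reasoning
    n≡0 : numerator z (φ z) ≡ 0#
    n≡0 = begin
      numerator z (φ z)                                    ≡⟨ φ²-denominator uz ⟨
      (z * φ z * φ z) * φ (φ (denominator z (φ z)))        ≡⟨ cong (λ d → (z * φ z * φ z) * φ (φ d)) d≡0 ⟩
      (z * φ z * φ z) * φ (φ 0#)                           ≡⟨ cong (z * φ z * φ z *_) (trans (cong φ φ-0) φ-0) ⟩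
      (z * φ z * φ z) * 0#                                 ≡⟨ zeroʳ _ ⟩
      0#                                                   ∎
    z≡1 : z ≡ 1#
    z≡1 = x∙y⁻¹≈ε⇒x≈y z 1# (x≢0∧xy≡0⇒y≡0 (unit⇒nonZero (unit-φ uz)) (begin
      φ z * (z - 1#)                                       ≡⟨ solve 2 (λ z Z → Z :* (z :- 𝟙) := den z Z :- num z Z) refl z (φ z) ⟩
      denominator z (φ z) - numerator z (φ z)              ≡⟨ cong₂ _-_ d≡0 n≡0 ⟩
      0# - 0#                                              ≡⟨ x-x≡0 0# ⟩
      0#                                                   ∎))

  ratio : Carrier → Carrier
  ratio z = numerator z (φ z) * denominator z (φ z) ⁻¹

  ratio-unit : ∀ {z} → Unit z → Unit (ratio z)
  ratio-unit {z} uz = *-cancelˡ-nonZero (denominator≢0 uz) (begin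
    d * (f * φ (φ f))                   ≡⟨ solve 3 (λ d f g → d :* (f :* g) := g :* (f :* d)) refl d f (φ (φ f)) ⟩
    φ (φ f) * (f * d)                   ≡⟨ cong (φ (φ f) *_) fd≡n ⟩
    φ (φ f) * n                         ≡⟨ cong (φ (φ f) *_) (φ²-denominator uz) ⟨
    φ (φ f) * (m * φ (φ d))             ≡⟨ solve 3 (λ f m d → f :* (m :* d) := m :* (f :* d)) refl (φ (φ f)) m (φ (φ d)) ⟩
    m * (φ (φ f) * φ (φ d))             ≡⟨ cong (m *_) (trans (cong φ (φ-* f d)) (φ-* (φ f) (φ d))) ⟨
    m * φ (φ (f * d))                   ≡⟨ cong (λ a → m * φ (φ a)) fd≡n ⟩
    m * φ (φ n)                         ≡⟨ φ²-numerator uz ⟩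
    d                                   ≡⟨ *-identityʳ d ⟨
    d * 1#                              ∎)
    where
    open ≡-Reasoning
    n d f m : Carrier
    n = numerator z (φ z)
    d = denominator z (φ z)
    f = ratio z
    m = z * φ z * φ z
    fd≡n : f * d ≡ n
    fd≡n = /-*-cancel (denominator≢0 uz) n

  ratio-injective : ∀ {z y} → Unit z → Unit y → ratio z ≡ ratio y → z ≡ y
  ratio-injective {z} {y} uz uy eq = fibre-injective uz uy (begin
    -- Cross-multiplication is unaffected when each denominator is replaced by denominator minus
    -- numerator, which is Z(z - 1).
    fibre z (φ z) y (φ y)               ≡⟨ solve 4 (λ z Z y Y → fib z Z y Y := num y Y :* den z Z :- num z Z :* den y Y) refl z (φ z) y (φ y) ⟩
    numerator y (φ y) * dz - numerator z (φ z) * dy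
                                        ≡⟨ cong₂ (λ a b → a * dz - b * dy) (/-*-cancel (denominator≢0 uy) _) (/-*-cancel (denominator≢0 uz) _) ⟨
    ratio y * dy * dz - ratio z * dz * dy
                                        ≡⟨ cong (λ f → ratio y * dy * dz - f * dz * dy) eq ⟩
    ratio y * dy * dz - ratio y * dz * dy
                                        ≡⟨ solve 3 (λ f a b → f :* a :* b :- f :* b :* a := con (pos 0)) refl (ratio y) dy dz ⟩
    0#                                  ∎)
    where
    open ≡-Reasoning
    dz dy : Carrier
    dz = denominator z (φ z)
    dy = denominator y (φ y)

  -- Here c = x − (φ²w + w) is the value of the map of part (a) at x, and z = x / φ²x.
  module TraceMap (φ⁴ : ∀ x → φ (φ (φ (φ x))) ≡ x) where

    traceMap : Carrier → Carrier → Carrier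
    traceMap x w = x - (φ (φ w) + w)

    -- The trace term is fixed by φ² because φ⁴ is the identity, so it drops out: the value alone
    -- determines x - φ²x.
    traceMap-φ² : ∀ x w → traceMap x w - φ (φ (traceMap x w)) ≡ x - φ (φ x)
    traceMap-φ² x w = begin
      x - t - φ (φ (x - t))             ≡⟨ cong (λ s → x - t - s) (trans (cong φ (φ-- x t)) (φ-- (φ x) (φ t))) ⟩
      x - t - (φ (φ x) - φ (φ t))       ≡⟨ cong (λ s → x - t - (φ (φ x) - s)) (trans (cong φ (φ-+ (φ (φ w)) w)) (φ-+ (φ (φ (φ w))) (φ w))) ⟩
      x - t - (φ (φ x) - (φ (φ (φ (φ w))) + φ (φ w)))
                                        ≡⟨ cong (λ s → x - t - (φ (φ x) - (s + φ (φ w)))) (φ⁴ w) ⟩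
      x - t - (φ (φ x) - (w + φ (φ w))) ≡⟨ solve 4 (λ x u w v → x :- (v :+ w) :- (u :- (w :+ v)) := x :- u) refl x (φ (φ x)) w (φ (φ w)) ⟩
      x - φ (φ x)                       ∎
      where
      open ≡-Reasoning
      t : Carrier
      t = φ (φ w) + w

    -- All nonzero x fixed by φ² are encoded by z = 1, so the encoding cannot separate them; on
    -- these points the map is negation.
    traceMap-fixed : ∀ {x w} → φ (φ x) ≡ x → w ≡ x → traceMap x w ≡ - x
    traceMap-fixed {x} φ²x≡x refl = trans (cong (λ u → x - (u + x)) φ²x≡x)
      (solve 1 (λ x → x :- (x :+ x) := :- x) refl x)

    -- The exponent Q³ + Q² - Q enters only through `w-def`, free of truncated subtraction and of
    -- division.
    module Moved {x w : Carrier} (w-def : w * φ x ≡ φ (φ (φ x)) * φ (φ x)) (moved : x - φ (φ x) ≢ 0#) where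
      u U X c δ z Z : Carrier
      u = φ (φ x)
      U = φ u
      X = φ x
      c = traceMap x w
      δ = x - u
      z = x * u ⁻¹
      Z = φ z

      u≢0 : u ≢ 0#
      u≢0 u≡0 = moved (trans (cong₂ _-_ x≡0 u≡0) (x-x≡0 0#))
        where
        x≡0 : x ≡ 0#
        x≡0 = trans (sym (φ⁴ x)) (trans (cong (φ ∘ φ) u≡0) (trans (cong φ φ-0) φ-0))

      U≢0 : U ≢ 0#
      U≢0 U≡0 = u≢0 (trans (sym (φ⁴ u)) (trans (cong (φ ∘ φ ∘ φ) U≡0) (trans (cong (φ ∘ φ) φ-0) (trans (cong φ φ-0) φ-0))))

      zu≡x : z * u ≡ x
      zu≡x = /-*-cancel u≢0 x

      ZU≡X : Z * U ≡ X
      ZU≡X = trans (sym (φ-* z u)) (cong φ zu≡x)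

      unit-z : Unit z
      unit-z = *-cancelˡ-nonZero u≢0 (begin
        u * (z * φ Z)                   ≡⟨ solve 3 (λ u z w → u :* (z :* w) := w :* (z :* u)) refl u z (φ Z) ⟩
        φ Z * (z * u)                   ≡⟨ cong (φ Z *_) (trans zu≡x (sym (φ⁴ x))) ⟩
        φ Z * φ U                       ≡⟨ φ-* Z U ⟨
        φ (Z * U)                       ≡⟨ cong φ ZU≡X ⟩
        u                               ≡⟨ *-identityʳ u ⟨
        u * 1#                          ∎)
        where open ≡-Reasoning

      w̄U≡Xx : φ (φ w) * U ≡ X * x
      w̄U≡Xx = begin
        φ (φ w) * φ (φ X)               ≡⟨ trans (cong φ (φ-* w X)) (φ-* (φ w) (φ X)) ⟨
        φ (φ (w * X))                   ≡⟨ cong (φ ∘ φ) w-def ⟩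
        φ (φ (U * u))                   ≡⟨ trans (cong φ (φ-* U u)) (φ-* (φ U) (φ u)) ⟩
        φ (φ U) * φ (φ u)               ≡⟨ cong₂ _*_ (cong φ (φ⁴ x)) (φ⁴ x) ⟩
        X * x                           ∎
        where open ≡-Reasoning

      -- As w = Uu/X and φ²w = Xx/U, the product cXU is a cubic form in x, X, u, U. Substituting x =
      -- zu and X = ZU splits off U²u and leaves minus the numerator.
      cZ≡-uN : c * Z ≡ - (u * numerator z Z)
      cZ≡-uN = *-cancelˡ-nonZero (*-nonZero U≢0 U≢0) (begin
        U * U * (c * Z)                 ≡⟨ solve 3 (λ U c Z → U :* U :* (c :* Z) := c :* (Z :* U) :* U) refl U c Z ⟩
        c * (Z * U) * U                 ≡⟨ cong (λ X → c * X * U) ZU≡X ⟩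
        c * X * U                       ≡⟨ solve 5 (λ x X U w v → (x :- (v :+ w)) :* X :* U := x :* X :* U :- (v :* U) :* X :- (w :* X) :* U) refl x X U w (φ (φ w)) ⟩
        x * X * U - (φ (φ w) * U) * X - (w * X) * U
                                        ≡⟨ cong₂ (λ a b → x * X * U - a * X - b * U) w̄U≡Xx w-def ⟩
        x * X * U - (X * x) * X - (U * u) * U
                                        ≡⟨ cong₂ (λ x X → x * X * U - (X * x) * X - (U * u) * U) zu≡x ZU≡X ⟨
        (z * u) * (Z * U) * U - ((Z * U) * (z * u)) * (Z * U) - (U * u) * U
                                        ≡⟨ solve 4 (λ z Z u U → (z :* u) :* (Z :* U) :* U :- ((Z :* U) :* (z :* u)) :* (Z :* U) :- (U :* u) :* U
                                             := U :* U :* (:- (u :* num z Z))) refl z Z u U ⟩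
        U * U * (- (u * numerator z Z)) ∎)
        where open ≡-Reasoning

      uz-u≡δ : u * (z - 1#) ≡ δ
      uz-u≡δ = trans (solve 2 (λ u z → u :* (z :- 𝟙) := z :* u :- u) refl u z) (cong (_- u) zu≡x)

      -- In cross-multiplied form, the quotient of Z(z - 1) by the numerator is -δ/c. Since δ is
      -- determined by c, equal values put the two encodings in one fibre.
      δN≡-cZ[z-1] : δ * numerator z Z ≡ - (c * (Z * (z - 1#)))
      δN≡-cZ[z-1] = begin
        δ * N                           ≡⟨ cong (_* N) uz-u≡δ ⟨
        u * (z - 1#) * N                ≡⟨ solve 3 (λ u z N → u :* (z :- 𝟙) :* N := :- (:- (u :* N) :* (z :- 𝟙))) refl u z N ⟩
        - (- (u * N) * (z - 1#))        ≡⟨ cong (λ a → - (a * (z - 1#))) cZ≡-uN ⟨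
        - (c * Z * (z - 1#))            ≡⟨ cong -_ (*-assoc c Z (z - 1#)) ⟩
        - (c * (Z * (z - 1#)))          ∎
        where
        open ≡-Reasoning
        N : Carrier
        N = numerator z Z

    traceMap-injective : ∀ {x w x′ w′} → w * φ x ≡ φ (φ (φ x)) * φ (φ x) → w′ * φ x′ ≡ φ (φ (φ x′)) * φ (φ x′) →
      x - φ (φ x) ≢ 0# → traceMap x w ≡ traceMap x′ w′ → x ≡ x′
    traceMap-injective {x} {w} {x′} {w′} w-def w′-def moved c≡c′ = begin
      x                                 ≡⟨ M.zu≡x ⟨
      M.z * M.u                         ≡⟨ cong₂ _*_ z≡z′ u≡u′ ⟩
      M′.z * M′.u                       ≡⟨ M′.zu≡x ⟩
      x′                                ∎
      where
      open ≡-Reasoning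
      δ≡δ′ : x - φ (φ x) ≡ x′ - φ (φ x′)
      δ≡δ′ = trans (sym (traceMap-φ² x w)) (trans (cong (λ c → c - φ (φ c)) c≡c′) (traceMap-φ² x′ w′))
      module M  = Moved w-def moved
      module M′ = Moved w′-def (moved ∘ trans δ≡δ′)
      p p′ : Carrier
      p  = M.Z * (M.z - 1#)
      p′ = M′.Z * (M′.z - 1#)
      z≡z′ : M.z ≡ M′.z
      z≡z′ = fibre-injective M.unit-z M′.unit-z (x≢0∧xy≡0⇒y≡0 moved (begin
        M.δ * fibre M.z M.Z M′.z M′.Z   ≡⟨ solve 5 (λ δ p p′ n n′ → δ :* (p :* n′ :- p′ :* n) := p :* (δ :* n′) :- p′ :* (δ :* n)) refl
                                             M.δ p p′ (numerator M.z M.Z) (numerator M′.z M′.Z) ⟩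
        p * (M.δ * numerator M′.z M′.Z) - p′ * (M.δ * numerator M.z M.Z)
                                        ≡⟨ cong₂ (λ a b → p * a - p′ * b)
                                             (trans (cong (_* numerator M′.z M′.Z) δ≡δ′) (trans M′.δN≡-cZ[z-1] (cong (λ c → - (c * p′)) (sym c≡c′))))
                                             M.δN≡-cZ[z-1] ⟩
        p * - (M.c * p′) - p′ * - (M.c * p)
                                        ≡⟨ solve 3 (λ c p p′ → p :* :- (c :* p′) :- p′ :* :- (c :* p) := con (pos 0)) refl M.c p p′ ⟩
        0#                              ∎))
      z-1≢0 : M.z - 1# ≢ 0#
      z-1≢0 eq = moved (trans (sym M.uz-u≡δ) (trans (cong (M.u *_) eq) (zeroʳ M.u)))
      -- The encoding forgets the scale of x, and δ restores it: u = δ/(z - 1).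
      u≡u′ : M.u ≡ M′.u
      u≡u′ = *-cancelˡ-nonZero z-1≢0 (begin
        (M.z - 1#) * M.u                ≡⟨ *-comm _ _ ⟩
        M.u * (M.z - 1#)                ≡⟨ M.uz-u≡δ ⟩
        M.δ                             ≡⟨ δ≡δ′ ⟩
        M′.δ                            ≡⟨ M′.uz-u≡δ ⟨
        M′.u * (M′.z - 1#)              ≡⟨ *-comm _ _ ⟩
        (M′.z - 1#) * M′.u              ≡⟨ cong (λ z → (z - 1#) * M′.u) z≡z′ ⟨
        (M.z - 1#) * M′.u               ∎)

  -- Here b is a square root of the nonsquare ν, h is the value of the map of part (b) at x, and
  -- z = (x + b) / (x − b).
  module Affine {b : Carrier} (φ²b≡-b : φ (φ b) ≡ - b) (2b≢0 : b + b ≢ 0#) where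

    B₀ : Carrier
    B₀ = φ b

    affineNumerator : Carrier → Carrier
    affineNumerator x = φ x * (x * x) + fromℕ 3 * (b * b) * φ x - fromℕ 4 * (b * B₀) * x

    2B≢0 : - (B₀ + B₀) ≢ 0#
    2B≢0 eq = 2b≢0 (begin
      b + b                             ≡⟨ solve 1 (λ b → b :+ b := :- :- (b :+ b)) refl b ⟩
      - - (b + b)                       ≡⟨ cong (λ a → - a) (solve 1 (λ b → :- (b :+ b) := :- b :+ :- b) refl b) ⟩
      - (- b + - b)                     ≡⟨ cong (λ a → - (a + a)) φ²b≡-b ⟨
      - (φ B₀ + φ B₀)                   ≡⟨ cong -_ (φ-+ B₀ B₀) ⟨
      - φ (B₀ + B₀)                     ≡⟨ φ-neg (B₀ + B₀) ⟨
      φ (- (B₀ + B₀))                   ≡⟨ cong φ eq ⟩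
      φ 0#                              ≡⟨ φ-0 ⟩
      0#                                ∎)
      where open ≡-Reasoning

    module Cayley {x h : Carrier} (φ²x≡x : φ (φ x) ≡ x) (den≢0 : x * x - b * b ≢ 0#)
                  (h-def : h * (x * x - b * b) ≡ affineNumerator x) where
      X a A₀ z Z : Carrier
      X  = φ x
      a  = x - b
      A₀ = X - B₀
      z  = (x + b) * a ⁻¹
      Z  = φ z

      a≢0 : a ≢ 0#
      a≢0 a≡0 = den≢0 (trans (solve 2 (λ x b → x :* x :- b :* b := (x :- b) :* (x :+ b)) refl x b)
                        (trans (cong (_* (x + b)) a≡0) (zeroˡ _)))

      za≡x+b : z * a ≡ x + b
      za≡x+b = /-*-cancel a≢0 (x + b)

      ZA≡X+B : Z * A₀ ≡ X + B₀
      ZA≡X+B = begin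
        Z * (X - B₀)                    ≡⟨ cong (Z *_) (φ-- x b) ⟨
        Z * φ a                         ≡⟨ φ-* z a ⟨
        φ (z * a)                       ≡⟨ cong φ za≡x+b ⟩
        φ (x + b)                       ≡⟨ φ-+ x b ⟩
        X + B₀                          ∎
        where open ≡-Reasoning

      unit-z : Unit z
      unit-z = *-cancelˡ-nonZero a≢0 (begin
        a * (z * φ Z)                   ≡⟨ solve 3 (λ a z w → a :* (z :* w) := w :* (z :* a)) refl a z (φ Z) ⟩
        φ Z * (z * a)                   ≡⟨ cong (φ Z *_) za≡x+b ⟩
        φ Z * (x + b)                   ≡⟨ cong (φ Z *_) (solve 2 (λ x b → x :+ b := x :- :- b) refl x b) ⟩
        φ Z * (x - - b)                 ≡⟨ cong₂ (λ x b → φ Z * (x - b)) φ²x≡x φ²b≡-b ⟨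
        φ Z * (φ X - φ B₀)              ≡⟨ cong (φ Z *_) (φ-- X B₀) ⟨
        φ Z * φ A₀                      ≡⟨ φ-* Z A₀ ⟨
        φ (Z * A₀)                      ≡⟨ cong φ ZA≡X+B ⟩
        φ (X + B₀)                      ≡⟨ φ-+ X B₀ ⟩
        φ X + φ B₀                      ≡⟨ cong₂ _+_ φ²x≡x φ²b≡-b ⟩
        x - b                           ≡⟨ *-identityʳ a ⟨
        a * 1#                          ∎)
        where open ≡-Reasoning

      [h+B]z : (h + B₀) * z ≡ A₀ * (Z - z + z * z)
      [h+B]z = *-cancelˡ-nonZero (*-nonZero a≢0 a≢0) (begin
        a * a * ((h + B₀) * z)          ≡⟨ solve 4 (λ a h B z → a :* a :* ((h :+ B) :* z) := (h :+ B) :* (a :* (z :* a))) refl a h B₀ z ⟩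
        (h + B₀) * (a * (z * a))        ≡⟨ cong (λ u → (h + B₀) * (a * u)) za≡x+b ⟩
        (h + B₀) * (a * (x + b))        ≡⟨ solve 4 (λ h B x b → (h :+ B) :* ((x :- b) :* (x :+ b)) := h :* (x :* x :- b :* b) :+ B :* (x :* x :- b :* b)) refl h B₀ x b ⟩
        h * (x * x - b * b) + B₀ * (x * x - b * b)
                                        ≡⟨ cong (_+ B₀ * (x * x - b * b)) h-def ⟩
        affineNumerator x + B₀ * (x * x - b * b)
                                        -- `3#` copies the unfolding of `fromℕ 3`, so that the
                                        -- solved equation matches `affineNumerator`. The
                                        -- coefficients 3 and -4 are what the three products on the
                                        -- right leave after B₀ times the denominator is subtracted.
                                        ≡⟨ solve 4 (λ x X b B →
                                             let 3# = 𝟙 :+ (𝟙 :+ (𝟙 :+ con (pos 0))) in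
                                             X :* (x :* x) :+ 3# :* (b :* b) :* X :- (𝟙 :+ 3#) :* (b :* B) :* x :+ B :* (x :* x :- b :* b)
                                             := (X :+ B) :* ((x :- b) :* (x :- b)) :- (x :+ b) :* (x :- b) :* (X :- B) :+ (x :+ b) :* (x :+ b) :* (X :- B)) refl
                                             x X b B₀ ⟩
        (X + B₀) * (a * a) - (x + b) * a * A₀ + (x + b) * (x + b) * A₀
                                        ≡⟨ cong₂ (λ u v → v * (a * a) - u * a * A₀ + u * u * A₀) za≡x+b ZA≡X+B ⟨
        (Z * A₀) * (a * a) - (z * a) * a * A₀ + (z * a) * (z * a) * A₀
                                        ≡⟨ solve 4 (λ z Z a A → (Z :* A) :* (a :* a) :- (z :* a) :* a :* A :+ (z :* a) :* (z :* a) :* A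
                                             := a :* a :* (A :* (Z :- z :+ z :* z))) refl z Z a A₀ ⟩
        a * a * (A₀ * (Z - z + z * z))  ∎)
        where open ≡-Reasoning

      -- The factor 1 - Z removes x, because A₀(1 - Z) = -2B₀. What remains says that the quotient
      -- of z(1 - Z) by Z - z + z² depends on h alone. That quotient belongs to φ(`ratio z`), so
      -- equal values give `fibre′` and not `fibre`.
      [h+B]z[1-Z] : (h + B₀) * (z * (1# - Z)) ≡ - (B₀ + B₀) * (Z - z + z * z)
      [h+B]z[1-Z] = begin
        (h + B₀) * (z * (1# - Z))       ≡⟨ *-assoc _ _ _ ⟨
        (h + B₀) * z * (1# - Z)         ≡⟨ cong (_* (1# - Z)) [h+B]z ⟩
        A₀ * e * (1# - Z)               ≡⟨ solve 3 (λ A e Z → A :* e :* (𝟙 :- Z) := (A :- Z :* A) :* e) refl A₀ e Z ⟩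
        (A₀ - Z * A₀) * e               ≡⟨ cong (λ v → (A₀ - v) * e) ZA≡X+B ⟩
        (X - B₀ - (X + B₀)) * e         ≡⟨ cong (_* e) (solve 2 (λ X B → X :- B :- (X :+ B) := :- (B :+ B)) refl X B₀) ⟩
        - (B₀ + B₀) * e                 ∎
        where
        open ≡-Reasoning
        e : Carrier
        e = Z - z + z * z

    affine-injective : ∀ {x y h} → φ (φ x) ≡ x → φ (φ y) ≡ y → x * x - b * b ≢ 0# → y * y - b * b ≢ 0# →
      h * (x * x - b * b) ≡ affineNumerator x → h * (y * y - b * b) ≡ affineNumerator y → x ≡ y
    affine-injective {x} {y} {h} fx fy dx dy hx hy = x∙y⁻¹≈ε⇒x≈y x y (x≢0∧xy≡0⇒y≡0 2b≢0 (begin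
      (b + b) * (x - y)                 ≡⟨ solve 3 (λ b x y → (b :+ b) :* (x :- y) := (y :+ b) :* (x :- b) :- (x :+ b) :* (y :- b)) refl b x y ⟩
      (y + b) * (x - b) - (x + b) * (y - b)
                                        ≡⟨ cong₂ (λ p q → p * (x - b) - q * (y - b)) N.za≡x+b M.za≡x+b ⟨
      N.z * (y - b) * (x - b) - M.z * (x - b) * (y - b)
                                        ≡⟨ cong (λ z → N.z * (y - b) * (x - b) - z * (x - b) * (y - b)) z≡z′ ⟩
      N.z * (y - b) * (x - b) - N.z * (x - b) * (y - b)
                                        ≡⟨ solve 3 (λ z p q → z :* p :* q :- z :* q :* p := con (pos 0)) refl N.z (y - b) (x - b) ⟩
      0#                                ∎))
      where
      open ≡-Reasoning
      module M = Cayley {x} {h} fx dx hx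
      module N = Cayley {y} {h} fy dy hy
      p q e f : Carrier
      p = M.z * (1# - M.Z)
      q = N.z * (1# - N.Z)
      e = M.Z - M.z + M.z * M.z
      f = N.Z - N.z + N.z * N.z
      z≡z′ : M.z ≡ N.z
      z≡z′ = fibre-injective M.unit-z N.unit-z (fibre′⇒fibre M.unit-z N.unit-z (x≢0∧xy≡0⇒y≡0 2B≢0 (begin
        - (B₀ + B₀) * (p * f - q * e)   ≡⟨ solve 5 (λ k p q e f → k :* (p :* f :- q :* e) := p :* (k :* f) :- q :* (k :* e)) refl (- (B₀ + B₀)) p q e f ⟩
        p * (- (B₀ + B₀) * f) - q * (- (B₀ + B₀) * e)
                                        ≡⟨ cong₂ (λ s t → p * s - q * t) N.[h+B]z[1-Z] M.[h+B]z[1-Z] ⟨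
        p * ((h + B₀) * q) - q * ((h + B₀) * p)
                                        ≡⟨ solve 3 (λ k p q → p :* (k :* q) :- q :* (k :* p) := con (pos 0)) refl (h + B₀) p q ⟩
        0#                              ∎)))

-- Finite fields

module FiniteFieldTheory {n : ℕ} (K : FiniteField n) where
  open FiniteField K renaming (_^_ to infixr 8 _^ᶠ_)
  open FieldTheory field' public
  open Inverse enumeration using (to; from; strictlyInverseˡ; strictlyInverseʳ)

  to-injective : ∀ {x y} → to x ≡ to y → x ≡ y
  to-injective {x} {y} eq = trans (sym (strictlyInverseʳ x)) (trans (cong from eq) (strictlyInverseʳ y))

  from-injective : ∀ {i j} → from i ≡ from j → i ≡ j
  from-injective {i} {j} eq = trans (sym (strictlyInverseˡ i)) (trans (cong to eq) (strictlyInverseˡ j))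

  infix 4 _≟_
  _≟_ : DecidableEquality Carrier
  x ≟ y with to x Fin.≟ to y
  ... | yes eq = yes (to-injective eq)
  ... | no  ne = no (ne ∘ cong to)

  open DecidableField _≟_ public

  injective⇒surjective : (f : Carrier → Carrier) → Injective _≡_ _≡_ f → ∀ y → ∃ λ x → f x ≡ y
  injective⇒surjective f inj y with Fin-injective⇒surjective (to ∘ f ∘ from) (from-injective ∘ inj ∘ to-injective) (to y)
  ... | i , eq = from i , to-injective eq

  -- Extended by the identity outside S, f becomes an injective self-map of the whole finite field.
  -- Closure of S under f keeps the images of the two pieces apart.
  injective⇒permutesOn : (S : Carrier → Set) (S? : ∀ x → Dec (S x)) (f : Carrier → Carrier) →
    (∀ x → S x → S (f x)) → (∀ x y → S x → S y → f x ≡ f y → x ≡ y) → PermutesOn S f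
  injective⇒permutesOn S S? f closed inj = closed , inj , λ y Sy → preimage y Sy (injective⇒surjective g g-inj y)
    where
    extend : ∀ x → Dec (S x) → Carrier
    extend x (yes _) = f x
    extend x (no _)  = x
    g : Carrier → Carrier
    g x = extend x (S? x)
    g-inj : Injective _≡_ _≡_ g
    g-inj {x} {y} eq with S? x | S? y
    ... | yes Sx | yes Sy = inj x y Sx Sy eq
    ... | yes Sx | no ¬Sy = contradiction (subst S eq (closed x Sx)) ¬Sy
    ... | no ¬Sx | yes Sy = contradiction (subst S (sym eq) (closed y Sy)) ¬Sx
    ... | no _   | no _   = eq
    preimage : ∀ y → S y → (∃ λ x → g x ≡ y) → Σ Carrier λ x → S x × f x ≡ y
    preimage y Sy (x , eq) with S? x
    ... | yes Sx = x , Sx , eq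
    ... | no ¬Sx = contradiction (subst S (sym eq) Sy) ¬Sx

  permutation : (f g : Carrier → Carrier) → (∀ x → f (g x) ≡ x) → (∀ x → g (f x) ≡ x) → Permutation n n
  permutation f g fg gf = mk↔ₛ′ (to ∘ f ∘ from) (to ∘ g ∘ from)
    (λ i → trans (cong (to ∘ f) (strictlyInverseʳ _)) (trans (cong to (fg _)) (strictlyInverseˡ i)))
    (λ i → trans (cong (to ∘ g) (strictlyInverseʳ _)) (trans (cong to (gf _)) (strictlyInverseˡ i)))

  private
    module ∑ = Sum +-commutativeMonoid
    module ∏ = Sum *-commutativeMonoid
  open import Algebra.Properties.Group (CommutativeRing.+-group commutativeRing) using (identityʳ-unique)

  ∑-const : ∀ m → ∑.sum {m} (λ _ → 1#) ≡ fromℕ m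
  ∑-const zero    = refl
  ∑-const (suc m) = cong (1# +_) (∑-const m)

  ∏-const : ∀ m x → ∏.sum {m} (λ _ → x) ≡ x ^ᶠ m
  ∏-const zero    x = refl
  ∏-const (suc m) x = cong (x *_) (∏-const m x)

  -- The translation by 1 permutes the field, but adds n · 1 to the sum of all elements.
  fromℕ-order : fromℕ n ≡ 0#
  fromℕ-order = identityʳ-unique (∑.sum from) (fromℕ n) (begin
    ∑.sum from + fromℕ n                      ≡⟨ cong (∑.sum from +_) (∑-const n) ⟨
    ∑.sum from + ∑.sum {n} (λ _ → 1#)         ≡⟨ ∑.∑-distrib-+ from (λ _ → 1#) ⟨
    ∑.sum (λ i → from i + 1#)                 ≡⟨ ∑.sum-cong-≗ (λ i → strictlyInverseʳ (from i + 1#)) ⟨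
    ∑.sum (λ i → from (to (from i + 1#)))     ≡⟨ ∑.sum-permute from (permutation (_+ 1#) (_- 1#)
                                                   (solve 1 (λ x → x :- con (pos 1) :+ con (pos 1) := x) refl)
                                                   (solve 1 (λ x → x :+ con (pos 1) :- con (pos 1) := x) refl)) ⟨
    ∑.sum from                                ∎)
    where open ≡-Reasoning

  -- The extra factor x stands in for the one missing at i, which avoids the exponent m - 1.
  ∏-except-one : ∀ {m} (i : Fin m) (t : Fin m → Carrier) {x} → t i ≡ 1# → (∀ j → j ≢ i → t j ≡ x) →
    x * ∏.sum t ≡ x ^ᶠ m
  ∏-except-one {suc m} i t {x} tᵢ≡1 tⱼ≡x = cong (x *_) (begin
    ∏.sum t                                   ≡⟨ ∏.sum-remove {i = i} t ⟩
    t i * ∏.sum (t ∘ punchIn i)               ≡⟨ cong₂ _*_ tᵢ≡1 (∏.sum-cong-≗ (λ j → tⱼ≡x (punchIn i j) (Fin.punchInᵢ≢i i j))) ⟩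
    1# * ∏.sum {m} (λ _ → x)                  ≡⟨ *-identityˡ _ ⟩
    ∏.sum {m} (λ _ → x)                       ≡⟨ ∏-const m x ⟩
    x ^ᶠ m                                    ∎)
    where open ≡-Reasoning

  ∏-nonZero : ∀ {m} (t : Fin m → Carrier) → (∀ i → t i ≢ 0#) → ∏.sum t ≢ 0#
  ∏-nonZero {zero}  t t≢0 eq = 0≢1 (sym eq)
  ∏-nonZero {suc m} t t≢0 = *-nonZero (t≢0 fzero) (∏-nonZero (t ∘ fsuc) (t≢0 ∘ fsuc))

  private
    ifZero_then_else_ : Carrier → Carrier → Carrier → Carrier
    ifZero z then a else b with z ≟ 0#
    ... | yes _ = a
    ... | no  _ = b

    ifZero-yes : ∀ {z a b} → z ≡ 0# → ifZero z then a else b ≡ a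
    ifZero-yes {z} z≡0 with z ≟ 0#
    ... | yes _  = refl
    ... | no z≢0 = contradiction z≡0 z≢0

    ifZero-no : ∀ {z a b} → z ≢ 0# → ifZero z then a else b ≡ b
    ifZero-no {z} z≢0 with z ≟ 0#
    ... | yes z≡0 = contradiction z≡0 z≢0
    ... | no _    = refl

  n≢0 : n ≢ 0
  n≢0 refl = contradiction (to 0#) λ ()

  -- Multiplication by x ≠ 0 permutes the nonzero elements; their product is the one of g over all elements.
  x^n≡x : ∀ x → x ^ᶠ n ≡ x
  x^n≡x x with x ≟ 0#
  ... | yes refl = 0^n≡0 n≢0
  ... | no x≢0 = begin
    x ^ᶠ n                                    ≡⟨ ∏-except-one (to 0#) (h ∘ from) (ifZero-yes (strictlyInverseʳ 0#))
                                                   (λ j j≢ → ifZero-no (λ eq → j≢ (trans (sym (strictlyInverseˡ j)) (cong to eq)))) ⟨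
    x * ∏.sum (h ∘ from)                      ≡⟨ cong (x *_) ∏h≡1 ⟩
    x * 1#                                    ≡⟨ *-identityʳ x ⟩
    x                                         ∎
    where
    open ≡-Reasoning
    g h : Carrier → Carrier
    g z = ifZero z then 1# else z
    h z = ifZero z then 1# else x
    g≢0 : ∀ z → g z ≢ 0#
    g≢0 z with z ≟ 0#
    ... | yes _  = 0≢1 ∘ sym
    ... | no z≢0 = z≢0
    g[xz]≡g[z]h[z] : ∀ z → g (x * z) ≡ g z * h z
    g[xz]≡g[z]h[z] z with z ≟ 0#
    ... | yes refl = trans (ifZero-yes (zeroʳ x)) (sym (*-identityˡ 1#))
    ... | no z≢0   = trans (ifZero-no (*-nonZero x≢0 z≢0)) (*-comm x z)
    ∏h≡1 : ∏.sum (h ∘ from) ≡ 1#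
    ∏h≡1 = *-cancelˡ-nonZero (∏-nonZero (g ∘ from) (g≢0 ∘ from)) (begin
      ∏.sum (g ∘ from) * ∏.sum (h ∘ from)     ≡⟨ ∏.∑-distrib-+ (g ∘ from) (h ∘ from) ⟨
      ∏.sum (λ i → g (from i) * h (from i))   ≡⟨ ∏.sum-cong-≗ (λ i → trans (cong g (strictlyInverseʳ (x * from i))) (g[xz]≡g[z]h[z] (from i))) ⟨
      ∏.sum (λ i → g (from (to (x * from i)))) ≡⟨ ∏.sum-permute (g ∘ from) (permutation (x *_) (x ⁻¹ *_)
                                                   (λ z → trans (sym (*-assoc x (x ⁻¹) z)) (trans (cong (_* z) (inverseʳ x x≢0)) (*-identityˡ z)))
                                                   (λ z → trans (sym (*-assoc (x ⁻¹) x z)) (trans (cong (_* z) (trans (*-comm (x ⁻¹) x) (inverseʳ x x≢0))) (*-identityˡ z)))) ⟨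
      ∏.sum (g ∘ from)                        ≡⟨ *-identityʳ _ ⟨
      ∏.sum (g ∘ from) * 1#                   ∎)

  -- Otherwise X^(m+2) - X, encoded by `cs`, would vanish on the whole field. The factor X makes 0 a
  -- root too, so an initial segment of the enumeration supplies m + 3 distinct roots.
  power-not-trivial : ∀ {m} → 2 ℕ.+ m ℕ.< n → ¬ (∀ x → x ≢ 0# → x ^ᶠ suc m ≡ 1#)
  power-not-trivial {m} m<n all-roots = monic-root-bound cs (from ∘ (λ i → inject≤ i m<n))
    (λ eq → Fin.inject≤-injective m<n m<n _ _ (from-injective eq)) (λ i → vanish (from (inject≤ i m<n)))
    where
    cs : Vec Carrier (suc (suc m))
    cs = 0# ∷ - 1# ∷ replicate m 0#
    vanish : ∀ x → evalMonic cs x ≡ 0#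
    vanish x with x ≟ 0#
    ... | yes refl = trans (+-identityˡ _) (zeroˡ _)
    ... | no x≢0 = begin
      0# + x * (- 1# + x * evalMonic (replicate m 0#) x)  ≡⟨ cong (λ e → 0# + x * (- 1# + x * e)) (evalMonic-power m x) ⟩
      0# + x * (- 1# + x ^ᶠ suc m)                        ≡⟨ cong (λ e → 0# + x * (- 1# + e)) (all-roots x x≢0) ⟩
      0# + x * (- 1# + 1#)                                ≡⟨ solve 1 (λ x → con (pos 0) :+ x :* (:- con (pos 1) :+ con (pos 1)) := con (pos 0)) refl x ⟩
      0#                                                  ∎
      where open ≡-Reasoning

  IsSquare : Carrier → Set
  IsSquare ν = ∃ λ b → b * b ≡ ν

  isSquare? : ∀ ν → Dec (IsSquare ν)
  isSquare? ν with Fin.any? (λ i → from i * from i ≟ ν)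
  ... | yes (i , eq) = yes (from i , eq)
  ... | no none = no λ (b , eq) → none (to b , trans (cong₂ _*_ (strictlyInverseʳ b) (strictlyInverseʳ b)) eq)

  -- Choosing one element in each pair ±y and squaring it, while sending the other one to ν y²,
  -- gives an injective map.
  nonsquare⇒x≡y²∨x≡νy² : ∀ {ν} → ν ≢ 0# → ¬ IsSquare ν → ∀ x → IsSquare x ⊎ ∃ λ y → ν * (y * y) ≡ x
  nonsquare⇒x≡y²∨x≡νy² {ν} ν≢0 nonsquare x = conclude (injective⇒surjective g g-inj x)
    where
    Half : Carrier → Set
    Half y = to y Fin.< to (- y)
    half? : ∀ y → Dec (Half y)
    half? y = to y Fin.<? to (- y)
    choose : ∀ y → Dec (Half y) → Carrier
    choose y (yes _) = y * y
    choose y (no _)  = ν * (y * y)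
    g : Carrier → Carrier
    g y = choose y (half? y)
    -- If y′ = 0 then y = 0, which is not in `Half` because 0 = -0; otherwise ν would be the square
    -- of y / y′.
    mixed : ∀ {y y′} → Half y → ¬ (y * y ≡ ν * (y′ * y′))
    mixed {y} {y′} hy eq with y′ ≟ 0#
    ... | yes refl = ℕ.<-irrefl (cong Fin.toℕ (cong to 0≡-0)) (subst Half y≡0 hy)
      where
      y≡0 : y ≡ 0#
      y≡0 = x^n≡0⇒x≡0 2 (trans (cong (y *_) (*-identityʳ y)) (trans eq (trans (cong (ν *_) (zeroˡ 0#)) (zeroʳ ν))))
      0≡-0 : 0# ≡ - 0#
      0≡-0 = sym -0#≈0#
    ... | no y′≢0 = nonsquare (y * y′ ⁻¹ , *-cancelˡ-nonZero (*-nonZero y′≢0 y′≢0) (begin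
      y′ * y′ * (y * y′ ⁻¹ * (y * y′ ⁻¹))    ≡⟨ solve 3 (λ y p q → p :* p :* (y :* q :* (y :* q)) := (y :* q :* p) :* (y :* q :* p)) refl y y′ (y′ ⁻¹) ⟩
      (y * y′ ⁻¹ * y′) * (y * y′ ⁻¹ * y′)    ≡⟨ cong₂ _*_ (/-*-cancel y′≢0 y) (/-*-cancel y′≢0 y) ⟩
      y * y                                  ≡⟨ eq ⟩
      ν * (y′ * y′)                          ≡⟨ *-comm ν _ ⟩
      y′ * y′ * ν                            ∎))
      where open ≡-Reasoning
    g-inj : Injective _≡_ _≡_ g
    g-inj {y} {y′} eq with half? y | half? y′
    ... | yes h | no _ = contradiction eq (mixed h)
    ... | no _ | yes h = contradiction (sym eq) (mixed h)
    ... | yes h | yes h′ with x²≡y²⇒x≡±y eq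
    ...   | inj₁ y≡y′ = y≡y′
    ...   | inj₂ refl = contradiction (subst (λ z → to (- y′) Fin.< to z) (-‿involutive y′) h) (ℕ.<-asym h′)
    g-inj {y} {y′} eq | no ¬h | no ¬h′ with x²≡y²⇒x≡±y (*-cancelˡ-nonZero ν≢0 eq)
    ...   | inj₁ y≡y′ = y≡y′
    ...   | inj₂ refl = to-injective (Fin.toℕ-injective (ℕ.≤-antisym (ℕ.≮⇒≥ ¬h′) (ℕ.≮⇒≥ (¬h ∘ subst (λ z → to (- y′) Fin.< to z) (sym (-‿involutive y′))))))
    conclude : (∃ λ y → g y ≡ x) → IsSquare x ⊎ ∃ λ y → ν * (y * y) ≡ x
    conclude (y , eq) with half? y
    ... | yes _ = inj₁ (y , eq)
    ... | no _  = inj₂ (y , eq)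

  -- If ν were not a square, every nonzero x would satisfy x^m = 1.
  euler-criterion : ∀ {m ν} → n ≡ 1 ℕ.+ 2 ℕ.* suc m → ν ^ᶠ suc m ≡ 1# → IsSquare ν
  euler-criterion {m} {ν} refl ν^m≡1 with isSquare? ν
  ... | yes square = square
  ... | no nonsquare = contradiction x^m≡1 (power-not-trivial (s≤s (s≤s (ℕ.≤-trans (ℕ.m≤m+n (suc m) 0) (ℕ.m≤n+m _ m)))))
    where
    open ≡-Reasoning
    ν≢0 : ν ≢ 0#
    ν≢0 refl = nonsquare (0# , zeroˡ 0#)
    [y²]^m≡1 : ∀ {y} → y ≢ 0# → (y * y) ^ᶠ suc m ≡ 1#
    [y²]^m≡1 {y} y≢0 = *-cancelˡ-nonZero y≢0 (begin
      y * (y * y) ^ᶠ suc m                ≡⟨ cong (λ a → y * a ^ᶠ suc m) (cong (y *_) (*-identityʳ y)) ⟨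
      y * (y ^ᶠ 2) ^ᶠ suc m               ≡⟨ cong (y *_) (^-assocʳ y 2 (suc m)) ⟩
      y ^ᶠ (1 ℕ.+ 2 ℕ.* suc m)            ≡⟨ x^n≡x y ⟩
      y                                   ≡⟨ *-identityʳ y ⟨
      y * 1#                              ∎)
    root≢0 : ∀ {x y} → x ≢ 0# → y * y ≡ x → y ≢ 0#
    root≢0 x≢0 eq refl = x≢0 (trans (sym eq) (zeroˡ 0#))
    x^m≡1 : ∀ x → x ≢ 0# → x ^ᶠ suc m ≡ 1#
    x^m≡1 x x≢0 with nonsquare⇒x≡y²∨x≡νy² ν≢0 nonsquare x
    ... | inj₁ (y , refl) = [y²]^m≡1 (root≢0 x≢0 refl)
    ... | inj₂ (y , refl) = begin
      (ν * (y * y)) ^ᶠ suc m              ≡⟨ ^-distrib-* ν (y * y) (suc m) ⟩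
      ν ^ᶠ suc m * (y * y) ^ᶠ suc m       ≡⟨ cong₂ _*_ ν^m≡1 ([y²]^m≡1 λ { refl → x≢0 (trans (cong (ν *_) (zeroˡ 0#)) (zeroʳ ν)) }) ⟩
      1# * 1#                             ≡⟨ *-identityˡ 1# ⟩
      1#                                  ∎

-- The Frobenius endomorphism in characteristic p

module Frobenius (F : Field) {p : ℕ} (p-prime : Prime p) (char-p : Field.fromℕ F p ≡ Field.0# F) where
  open Field F renaming (_^_ to infixr 8 _^ᶠ_)
  open FieldTheory F
  open import Algebra.Properties.CommutativeSemiring.Binomial commutativeSemiring
  open import Algebra.Properties.Semiring.Exp semiring using () renaming (_^_ to infixr 8 _^ˢ_)
  open import Algebra.Properties.Semiring.Mult semiring using () renaming (_×_ to _·_)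
  open Sum +-commutativeMonoid

  ^ˢ≡^ : ∀ x n → x ^ˢ n ≡ x ^ᶠ n
  ^ˢ≡^ x zero    = refl
  ^ˢ≡^ x (suc n) = cong (x *_) (^ˢ≡^ x n)

  ·≡fromℕ* : ∀ n x → n · x ≡ fromℕ n * x
  ·≡fromℕ* zero    x = sym (zeroˡ x)
  ·≡fromℕ* (suc n) x = trans (cong (x +_) (·≡fromℕ* n x))
    (solve 2 (λ n x → x :+ n :* x := (con (pos 1) :+ n) :* x) refl (fromℕ n) x)

  p∣n⇒n·x≡0 : ∀ {n} x → p ∣ n → n · x ≡ 0#
  p∣n⇒n·x≡0 {n} x (divides q refl) = begin
    (q ℕ.* p) · x               ≡⟨ ·≡fromℕ* (q ℕ.* p) x ⟩
    fromℕ (q ℕ.* p) * x         ≡⟨ cong (_* x) (fromℕ-* q p) ⟩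
    fromℕ q * fromℕ p * x       ≡⟨ cong (λ c → fromℕ q * c * x) char-p ⟩
    fromℕ q * 0# * x            ≡⟨ solve 2 (λ q x → q :* con (pos 0) :* x := con (pos 0)) refl (fromℕ q) x ⟩
    0#                          ∎
    where open ≡-Reasoning

  -- The inner binomial coefficients are divisible by p. Index 0 carries the pure power of y, hence
  -- the order of the summands.
  expansion : ∀ m x y → suc m ≡ p → binomialExpansion x y (suc m) ≡ y ^ᶠ suc m + x ^ᶠ suc m
  expansion m x y refl = cong₂ _+_ first (begin
    sum (term ∘ fsuc)                                           ≡⟨ sum-init-last (term ∘ fsuc) ⟩
    sum (λ i → term (fsuc (Fin.inject₁ i))) + term (fsuc (Fin.fromℕ m)) ≡⟨ cong₂ _+_ (trans (sum-cong-≗ middle) (sum-replicate-zero m)) final ⟩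
    0# + x ^ᶠ suc m                                             ≡⟨ +-identityˡ _ ⟩
    x ^ᶠ suc m                                                  ∎)
    where
    open ≡-Reasoning
    term : Fin (suc (suc m)) → Carrier
    term = binomialTerm x y (suc m)
    first : term fzero ≡ y ^ᶠ suc m
    first = trans (+-identityʳ _) (trans (*-identityˡ _) (^ˢ≡^ y (suc m)))
    middle : ∀ i → term (fsuc (Fin.inject₁ i)) ≡ 0#
    middle i = p∣n⇒n·x≡0 _ (prime∣pCk p-prime (s≤s (subst (ℕ._< m) (sym (Fin.toℕ-inject₁ i)) (Fin.toℕ<n i))))
    final : term (fsuc (Fin.fromℕ m)) ≡ x ^ᶠ suc m
    final = begin
      (suc m C suc k) · (x ^ˢ suc k * y ^ˢ (m ℕ.∸ k))           ≡⟨ cong (λ k → (suc m C suc k) · (x ^ˢ suc k * y ^ˢ (m ℕ.∸ k))) (Fin.toℕ-fromℕ m) ⟩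
      (suc m C suc m) · (x ^ˢ suc m * y ^ˢ (m ℕ.∸ m))           ≡⟨ cong₂ (λ c e → c · (x ^ˢ suc m * y ^ˢ e)) (nCn≡1 (suc m)) (ℕ.n∸n≡0 m) ⟩
      1 · (x ^ˢ suc m * 1#)                                     ≡⟨ trans (+-identityʳ _) (*-identityʳ _) ⟩
      x ^ˢ suc m                                                ≡⟨ ^ˢ≡^ x (suc m) ⟩
      x ^ᶠ suc m                                                ∎
      where
      k : ℕ
      k = Fin.toℕ (Fin.fromℕ m)

  [x+y]^p : ∀ x y → (x + y) ^ᶠ p ≡ x ^ᶠ p + y ^ᶠ p
  [x+y]^p x y = go p refl
    where
    go : ∀ n → n ≡ p → (x + y) ^ᶠ n ≡ x ^ᶠ n + y ^ᶠ n
    go zero    eq = contradiction (subst Prime (sym eq) p-prime) ¬prime[0]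
    go (suc m) eq = trans (sym (^ˢ≡^ (x + y) (suc m)))
      (trans (theorem (suc m) x y) (trans (expansion m x y eq) (+-comm _ _)))

  [x+y]^p^k : ∀ k x y → (x + y) ^ᶠ (p ^ k) ≡ x ^ᶠ (p ^ k) + y ^ᶠ (p ^ k)
  [x+y]^p^k zero    x y = solve 2 (λ x y → (x :+ y) :* con (pos 1) := x :* con (pos 1) :+ y :* con (pos 1)) refl x y
  [x+y]^p^k (suc k) x y = begin
    (x + y) ^ᶠ (p ℕ.* p ^ k)                      ≡⟨ ^-assocʳ (x + y) p (p ^ k) ⟨
    ((x + y) ^ᶠ p) ^ᶠ (p ^ k)                     ≡⟨ cong (_^ᶠ (p ^ k)) ([x+y]^p x y) ⟩
    (x ^ᶠ p + y ^ᶠ p) ^ᶠ (p ^ k)                  ≡⟨ [x+y]^p^k k (x ^ᶠ p) (y ^ᶠ p) ⟩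
    (x ^ᶠ p) ^ᶠ (p ^ k) + (y ^ᶠ p) ^ᶠ (p ^ k)     ≡⟨ cong₂ _+_ (^-assocʳ x p (p ^ k)) (^-assocʳ y p (p ^ k)) ⟩
    x ^ᶠ (p ℕ.* p ^ k) + y ^ᶠ (p ℕ.* p ^ k)       ∎
    where open ≡-Reasoning

  frobenius-isEndomorphism : ∀ k → IsEndomorphism F (_^ᶠ (p ^ k))
  frobenius-isEndomorphism k = record
    { φ-+ = [x+y]^p^k k ; φ-* = λ x y → ^-distrib-* x y (p ^ k) ; φ-1 = 1^n≡1 (p ^ k) }

-- The three claims over the field with Q⁴ elements

module Main (Q : ℕ) {p k : ℕ} (p-prime : Prime p) (p≢2 : p ≢ 2) (Q≡p^k : Q ≡ p ^ k) (K : FiniteField (Q ^ 4)) where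
  open FiniteField K renaming (_^_ to infixr 8 _^ᶠ_)
  open FiniteFieldTheory K
  open Thm7p1 Q K

  Q^2≡Q*Q : Q ^ 2 ≡ Q ℕ.* Q
  Q^2≡Q*Q = cong (Q ℕ.*_) (ℕ.*-identityʳ Q)

  odd-Q : Odd Q
  odd-Q = subst Odd (sym Q≡p^k) (odd-^ k (odd-prime p-prime p≢2))

  -- The order Q⁴ is zero in the field, and a field has no nonzero nilpotents.
  fromℕ-Q : fromℕ Q ≡ 0#
  fromℕ-Q = x^n≡0⇒x≡0 4 (trans (sym (fromℕ-^ Q 4)) fromℕ-order)

  char-p : fromℕ p ≡ 0#
  char-p = x^n≡0⇒x≡0 k (trans (sym (fromℕ-^ p k)) (trans (cong fromℕ (sym Q≡p^k)) fromℕ-Q))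

  -- Q is odd and zero in the field; if 2 were zero as well, so would be 1.
  2≢0 : 1# + 1# ≢ 0#
  2≢0 2≡0 = 0≢1 (sym (begin
    1#                                  ≡⟨ solve 1 (λ j → 𝟙 := 𝟙 :+ con (pos 0) :* j) refl (fromℕ j) ⟩
    1# + 0# * fromℕ j                   ≡⟨ cong (λ a → 1# + a * fromℕ j) 2≡0 ⟨
    1# + (1# + 1#) * fromℕ j            ≡⟨ cong (λ a → 1# + (1# + a) * fromℕ j) (+-identityʳ 1#) ⟨
    1# + fromℕ 2 * fromℕ j              ≡⟨ cong (1# +_) (fromℕ-* 2 j) ⟨
    fromℕ (1 ℕ.+ 2 ℕ.* j)               ≡⟨ cong fromℕ (proj₂ odd-Q) ⟨
    fromℕ Q                             ≡⟨ fromℕ-Q ⟩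
    0#                                  ∎))
    where
    open ≡-Reasoning
    j : ℕ
    j = proj₁ odd-Q
    𝟙 : Polynomial 1
    𝟙 = con (pos 1)

  φ : Carrier → Carrier
  φ x = x ^ᶠ Q

  φ-isEndomorphism : IsEndomorphism field' φ
  φ-isEndomorphism = subst (λ q → IsEndomorphism field' (_^ᶠ q)) (sym Q≡p^k)
    (Frobenius.frobenius-isEndomorphism field' p-prime char-p k)

  open IsEndomorphism φ-isEndomorphism
  open Endomorphism field' _≟_ φ φ-isEndomorphism

  x^Q²≡φ²x : ∀ x → x ^ᶠ (Q ^ 2) ≡ φ (φ x)
  x^Q²≡φ²x x = trans (cong (x ^ᶠ_) Q^2≡Q*Q) (sym (^-assocʳ x Q Q))

  x^Q³≡φ³x : ∀ x → x ^ᶠ (Q ^ 3) ≡ φ (φ (φ x))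
  x^Q³≡φ³x x = trans (sym (^-assocʳ x Q (Q ^ 2))) (x^Q²≡φ²x (φ x))

  φ⁴ : ∀ x → φ (φ (φ (φ x))) ≡ x
  φ⁴ x = trans (sym (x^Q³≡φ³x (φ x))) (trans (^-assocʳ x Q (Q ^ 3)) (x^n≡x x))

  inFQ2⇒fixed : ∀ {x} → InFQ2 x → φ (φ x) ≡ x
  inFQ2⇒fixed {x} = trans (sym (x^Q²≡φ²x x))

  fixed⇒inFQ2 : ∀ {x} → φ (φ x) ≡ x → InFQ2 x
  fixed⇒inFQ2 {x} = trans (x^Q²≡φ²x x)

  φ²-+ : ∀ x y → φ (φ (x + y)) ≡ φ (φ x) + φ (φ y)
  φ²-+ x y = trans (cong φ (φ-+ x y)) (φ-+ (φ x) (φ y))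

  φ²-* : ∀ x y → φ (φ (x * y)) ≡ φ (φ x) * φ (φ y)
  φ²-* x y = trans (cong φ (φ-* x y)) (φ-* (φ x) (φ y))

  inFQ2-0 : InFQ2 0#
  inFQ2-0 = fixed⇒inFQ2 (trans (cong φ φ-0) φ-0)

  inFQ2-1 : InFQ2 1#
  inFQ2-1 = 1^n≡1 (Q ^ 2)

  inFQ2-+ : ∀ {x y} → InFQ2 x → InFQ2 y → InFQ2 (x + y)
  inFQ2-+ {x} {y} hx hy = fixed⇒inFQ2 (trans (φ²-+ x y) (cong₂ _+_ (inFQ2⇒fixed hx) (inFQ2⇒fixed hy)))

  inFQ2-neg : ∀ {x} → InFQ2 x → InFQ2 (- x)
  inFQ2-neg {x} hx = fixed⇒inFQ2 (trans (cong φ (φ-neg x)) (trans (φ-neg (φ x)) (cong -_ (inFQ2⇒fixed hx))))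

  inFQ2-* : ∀ {x y} → InFQ2 x → InFQ2 y → InFQ2 (x * y)
  inFQ2-* {x} {y} hx hy = trans (^-distrib-* x y (Q ^ 2)) (cong₂ _*_ hx hy)

  inFQ2-^ : ∀ {x} n → InFQ2 x → InFQ2 (x ^ᶠ n)
  inFQ2-^ zero    hx = inFQ2-1
  inFQ2-^ (suc n) hx = inFQ2-* hx (inFQ2-^ n hx)

  inFQ2-fromℕ : ∀ n → InFQ2 (fromℕ n)
  inFQ2-fromℕ zero    = inFQ2-0
  inFQ2-fromℕ (suc n) = inFQ2-+ inFQ2-1 (inFQ2-fromℕ n)

  inFQ2-/ : ∀ {n d} → d ≢ 0# → InFQ2 n → InFQ2 d → InFQ2 (n * d ⁻¹)
  inFQ2-/ {n} {d} d≢0 hn hd = *-cancelˡ-nonZero d≢0 (begin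
    d * (n * d ⁻¹) ^ᶠ (Q ^ 2)              ≡⟨ *-comm d _ ⟩
    (n * d ⁻¹) ^ᶠ (Q ^ 2) * d              ≡⟨ cong ((n * d ⁻¹) ^ᶠ (Q ^ 2) *_) hd ⟨
    (n * d ⁻¹) ^ᶠ (Q ^ 2) * d ^ᶠ (Q ^ 2)   ≡⟨ ^-distrib-* (n * d ⁻¹) d (Q ^ 2) ⟨
    (n * d ⁻¹ * d) ^ᶠ (Q ^ 2)              ≡⟨ cong (_^ᶠ (Q ^ 2)) (/-*-cancel d≢0 n) ⟩
    n ^ᶠ (Q ^ 2)                           ≡⟨ hn ⟩
    n                                      ≡⟨ /-*-cancel d≢0 n ⟨
    n * d ⁻¹ * d                           ≡⟨ *-comm _ d ⟩
    d * (n * d ⁻¹)                         ∎)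
    where open ≡-Reasoning

  open TraceMap φ⁴

  e : ℕ
  e = Q ^ 3 ℕ.+ Q ^ 2 ℕ.∸ Q

  Q≢0 : Q ≢ 0
  Q≢0 refl = n≢0 refl

  Q≤Q^2 : Q ℕ.≤ Q ^ 2
  Q≤Q^2 = subst (Q ℕ.≤_) (sym Q^2≡Q*Q) (ℕ.m≤m*n Q Q {{ℕ.≢-nonZero Q≢0}})

  e≢0 : e ≢ 0
  e≢0 e≡0 = n≢0 (trans (cong (Q ℕ.*_) (ℕ.m+n≡0⇒m≡0 (Q ^ 3) (trans (sym (ℕ.+-∸-assoc (Q ^ 3) Q≤Q^2)) e≡0))) (ℕ.*-zeroʳ Q))

  x^e-def : ∀ x → x ^ᶠ e * φ x ≡ φ (φ (φ x)) * φ (φ x)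
  x^e-def x = begin
    x ^ᶠ e * x ^ᶠ Q                        ≡⟨ ^-homo-* x e Q ⟨
    x ^ᶠ (e ℕ.+ Q)                         ≡⟨ cong (x ^ᶠ_) (ℕ.m∸n+n≡m (ℕ.≤-trans Q≤Q^2 (ℕ.m≤n+m (Q ^ 2) (Q ^ 3)))) ⟩
    x ^ᶠ (Q ^ 3 ℕ.+ Q ^ 2)                 ≡⟨ ^-homo-* x (Q ^ 3) (Q ^ 2) ⟩
    x ^ᶠ (Q ^ 3) * x ^ᶠ (Q ^ 2)            ≡⟨ cong₂ _*_ (x^Q³≡φ³x x) (x^Q²≡φ²x x) ⟩
    φ (φ (φ x)) * φ (φ x)                  ∎
    where open ≡-Reasoning

  F₆≡traceMap : ∀ x → F₆ x ≡ traceMap x (x ^ᶠ e)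
  F₆≡traceMap x = cong (λ a → x - (a + x ^ᶠ e)) (x^Q²≡φ²x (x ^ᶠ e))

  x^e-fixed : ∀ {x} → φ (φ x) ≡ x → x ^ᶠ e ≡ x
  x^e-fixed {x} fx with x ≟ 0#
  -- Cancelling φ x fails here, and the power of 0 is 0 only because e is positive.
  ... | yes refl = 0^n≡0 e≢0
  ... | no x≢0 = *-cancelˡ-nonZero (^-nonZero Q x≢0) (begin
    φ x * x ^ᶠ e                           ≡⟨ *-comm (φ x) (x ^ᶠ e) ⟩
    x ^ᶠ e * φ x                           ≡⟨ x^e-def x ⟩
    φ (φ (φ x)) * φ (φ x)                  ≡⟨ cong (λ u → φ u * u) fx ⟩
    φ x * x                                ∎)
    where open ≡-Reasoning

  -- The value determines x - φ²x, hence also whether both points are fixed by φ² or neither is.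
  F₆-injective : ∀ x y → F₆ x ≡ F₆ y → x ≡ y
  F₆-injective x y eq with x - φ (φ x) ≟ 0#
  ... | no moved = traceMap-injective {x} {x ^ᶠ e} {y} {y ^ᶠ e} (x^e-def x) (x^e-def y) moved
                     (trans (sym (F₆≡traceMap x)) (trans eq (F₆≡traceMap y)))
  ... | yes fixed = begin
    x                                      ≡⟨ -‿involutive x ⟨
    - - x                                  ≡⟨ cong -_ (F₆-fixed x fixed) ⟨
    - F₆ x                                 ≡⟨ cong -_ eq ⟩
    - F₆ y                                 ≡⟨ cong -_ (F₆-fixed y (trans (sym δ≡δ′) fixed)) ⟩
    - - y                                  ≡⟨ -‿involutive y ⟩
    y                                      ∎
    where
    open ≡-Reasoning
    F₆-δ : ∀ x → F₆ x - φ (φ (F₆ x)) ≡ x - φ (φ x)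
    F₆-δ x = trans (cong (λ c → c - φ (φ c)) (F₆≡traceMap x)) (traceMap-φ² x (x ^ᶠ e))
    δ≡δ′ : x - φ (φ x) ≡ y - φ (φ y)
    δ≡δ′ = trans (sym (F₆-δ x)) (trans (cong (λ c → c - φ (φ c)) eq) (F₆-δ y))
    F₆-fixed : ∀ x → x - φ (φ x) ≡ 0# → F₆ x ≡ - x
    F₆-fixed x δ≡0 = trans (F₆≡traceMap x) (traceMap-fixed fx (x^e-fixed fx))
      where
      fx : φ (φ x) ≡ x
      fx = sym (x∙y⁻¹≈ε⇒x≈y _ _ δ≡0)

  F₆-permutes : PermutesOn (λ _ → ⊤) F₆
  F₆-permutes = injective⇒permutesOn _ (λ _ → yes tt) F₆ (λ _ _ → tt) (λ x y _ _ → F₆-injective x y)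

  module PartB {ν : Carrier} (ν∈FQ2 : InFQ2 ν) (nonsquare : NonsquareFQ2 ν) where

    ν≢0 : ν ≢ 0#
    ν≢0 refl = nonsquare (0# , inFQ2-0 , zeroˡ 0#)

    -- Elements of the subfield become squares in the quadratic extension: ν to the power (Q⁴ - 1)/2
    -- is the (Q² + 1)/2-th power of ν^(Q² - 1) = 1.
    sqrt : IsSquare ν
    sqrt = go (odd-* odd-Q odd-Q)
      where
      open ≡-Reasoning
      Q^4≡Q²*Q² : Q ^ 4 ≡ (Q ℕ.* Q) ℕ.* (Q ℕ.* Q)
      Q^4≡Q²*Q² = trans (ℕ.^-distribˡ-+-* Q 2 2) (cong₂ ℕ._*_ Q^2≡Q*Q Q^2≡Q*Q)
      go : Odd (Q ℕ.* Q) → IsSquare ν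
      -- Here Q² = 1, and a field with one element would have 1 = 0.
      go (zero , eq) = contradiction (trans (sym fromℕ-order) (trans (cong fromℕ (trans Q^4≡Q²*Q² (cong₂ ℕ._*_ eq eq))) (+-identityʳ 1#))) 0≢1
      go (suc j , eq) = euler-criterion {ℕ.pred M} n≡1+2M (begin
        ν ^ᶠ (2 ℕ.* suc j ℕ.* (2 ℕ.+ j))       ≡⟨ ^-assocʳ ν (2 ℕ.* suc j) (2 ℕ.+ j) ⟨
        (ν ^ᶠ (2 ℕ.* suc j)) ^ᶠ (2 ℕ.+ j)      ≡⟨ cong (_^ᶠ (2 ℕ.+ j)) ν^[Q²-1]≡1 ⟩
        1# ^ᶠ (2 ℕ.+ j)                        ≡⟨ 1^n≡1 (2 ℕ.+ j) ⟩
        1#                                     ∎)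
        where
        M : ℕ
        M = 2 ℕ.* suc j ℕ.* (2 ℕ.+ j)
        n≡1+2M : Q ^ 4 ≡ 1 ℕ.+ 2 ℕ.* M
        n≡1+2M = trans Q^4≡Q²*Q² (trans (cong₂ ℕ._*_ eq eq) ([1+2j]² (suc j)))
        ν^[Q²-1]≡1 : ν ^ᶠ (2 ℕ.* suc j) ≡ 1#
        ν^[Q²-1]≡1 = *-cancelˡ-nonZero ν≢0 (begin
          ν ^ᶠ (1 ℕ.+ 2 ℕ.* suc j)             ≡⟨ cong (ν ^ᶠ_) (trans (sym eq) (sym Q^2≡Q*Q)) ⟩
          ν ^ᶠ (Q ^ 2)                         ≡⟨ ν∈FQ2 ⟩
          ν                                    ≡⟨ *-identityʳ ν ⟨
          ν * 1#                               ∎)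

    b : Carrier
    b = proj₁ sqrt

    b²≡ν : b * b ≡ ν
    b²≡ν = proj₂ sqrt

    b≢0 : b ≢ 0#
    b≢0 b≡0 = ν≢0 (trans (sym b²≡ν) (trans (cong (_* b) b≡0) (zeroˡ b)))

    -- φ²b is again a square root of ν, and it differs from b since otherwise ν would be a square in
    -- the subfield.
    φ²b≡-b : φ (φ b) ≡ - b
    φ²b≡-b with x²≡y²⇒x≡±y (trans (sym (φ²-* b b)) (trans (cong (φ ∘ φ) b²≡ν) (trans (inFQ2⇒fixed ν∈FQ2) (sym b²≡ν))))
    ... | inj₁ fixed = contradiction (b , fixed⇒inFQ2 fixed , b²≡ν) nonsquare
    ... | inj₂ eq    = eq

    2b≢0 : b + b ≢ 0#
    2b≢0 eq = *-nonZero 2≢0 b≢0 (trans (solve 1 (λ b → (con (pos 1) :+ con (pos 1)) :* b := b :+ b) refl b) eq)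

    open Affine φ²b≡-b 2b≢0

    ν^[Q+1]/2 : ν ^ᶠ ((Q ℕ.+ 1) ℕ./ 2) ≡ b * φ b
    ν^[Q+1]/2 = begin
      ν ^ᶠ ((Q ℕ.+ 1) ℕ./ 2)               ≡⟨ cong (λ n → ν ^ᶠ (n ℕ./ 2)) Q+1≡2[1+j] ⟩
      ν ^ᶠ (suc j ℕ.* 2 ℕ./ 2)             ≡⟨ cong (ν ^ᶠ_) (ℕ.m*n/n≡m (suc j) 2) ⟩
      ν ^ᶠ suc j                           ≡⟨ cong (_^ᶠ suc j) b²≡ν ⟨
      (b * b) ^ᶠ suc j                     ≡⟨ cong (λ a → (b * a) ^ᶠ suc j) (*-identityʳ b) ⟨
      (b ^ᶠ 2) ^ᶠ suc j                    ≡⟨ ^-assocʳ b 2 (suc j) ⟩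
      b ^ᶠ (2 ℕ.* suc j)                   ≡⟨ cong (b ^ᶠ_) (trans (ℕ.*-comm 2 (suc j)) (trans (sym Q+1≡2[1+j]) (ℕ.+-comm Q 1))) ⟩
      b * φ b                              ∎
      where
      open ≡-Reasoning
      j : ℕ
      j = proj₁ odd-Q
      Q+1≡2[1+j] : Q ℕ.+ 1 ≡ suc j ℕ.* 2
      Q+1≡2[1+j] = trans (cong (ℕ._+ 1) (proj₂ odd-Q)) ([1+2j]+1 j)

    numB≡affineNumerator : ∀ x → numB ν x ≡ affineNumerator x
    numB≡affineNumerator x = cong₂ _-_
      (cong₂ _+_ (trans (^-homo-* x Q 2) (cong (λ a → φ x * (x * a)) (*-identityʳ x)))
                 (cong (λ a → fromℕ 3 * a * φ x) (sym b²≡ν)))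
      (cong (λ a → fromℕ 4 * a * x) ν^[Q+1]/2)

    denB≡ : ∀ x → denB ν x ≡ x * x - b * b
    denB≡ x = cong₂ (λ a c → x * a - c) (*-identityʳ x) (sym b²≡ν)

    denB≢0 : ∀ x → InFQ2 x → denB ν x ≢ 0#
    denB≢0 x hx eq = nonsquare (x , hx , x∙y⁻¹≈ε⇒x≈y _ _ (trans (cong (λ a → x * a - ν) (sym (*-identityʳ x))) eq))

    fB : Carrier → Carrier
    fB x = numB ν x * denB ν x ⁻¹

    fB-closed : ∀ x → InFQ2 x → InFQ2 (fB x)
    fB-closed x hx = inFQ2-/ (denB≢0 x hx)
      (inFQ2-+ (inFQ2-+ (inFQ2-^ (Q ℕ.+ 2) hx) (inFQ2-* (inFQ2-* (inFQ2-fromℕ 3) ν∈FQ2) (inFQ2-^ Q hx)))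
               (inFQ2-neg (inFQ2-* (inFQ2-* (inFQ2-fromℕ 4) (inFQ2-^ ((Q ℕ.+ 1) ℕ./ 2) ν∈FQ2)) hx)))
      (inFQ2-+ (inFQ2-^ 2 hx) (inFQ2-neg ν∈FQ2))

    fB-def : ∀ x → InFQ2 x → fB x * (x * x - b * b) ≡ affineNumerator x
    fB-def x hx = trans (cong (fB x *_) (sym (denB≡ x))) (trans (/-*-cancel (denB≢0 x hx) (numB ν x)) (numB≡affineNumerator x))

    fB-injective : ∀ x y → InFQ2 x → InFQ2 y → fB x ≡ fB y → x ≡ y
    fB-injective x y hx hy eq = affine-injective (inFQ2⇒fixed hx) (inFQ2⇒fixed hy)
      (λ d → denB≢0 x hx (trans (denB≡ x) d)) (λ d → denB≢0 y hy (trans (denB≡ y) d))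
      (fB-def x hx) (trans (cong (_* (y * y - b * b)) eq) (fB-def y hy))

    permutes : PermutesRat field' InFQ2 (numB ν) (denB ν)
    permutes = denB≢0 , injective⇒permutesOn InFQ2 (λ x → x ^ᶠ (Q ^ 2) ≟ x) fB fB-closed fB-injective

  x^[Q²+1]≡xφ²x : ∀ x → x ^ᶠ (Q ^ 2 ℕ.+ 1) ≡ x * φ (φ x)
  x^[Q²+1]≡xφ²x x = trans (cong (x ^ᶠ_) (ℕ.+-comm (Q ^ 2) 1)) (cong (x *_) (x^Q²≡φ²x x))

  μ⇒unit : ∀ {x} → μ x → Unit x
  μ⇒unit {x} (_ , eq) = trans (sym (x^[Q²+1]≡xφ²x x)) eq

  unit⇒μ : ∀ {x} → Unit x → μ x
  unit⇒μ {x} ux = unit⇒nonZero ux , trans (x^[Q²+1]≡xφ²x x) ux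

  μ? : ∀ x → Dec (μ x)
  μ? x with x ≟ 0# | x ^ᶠ (Q ^ 2 ℕ.+ 1) ≟ 1#
  ... | yes x≡0 | _      = no λ (x≢0 , _) → x≢0 x≡0
  ... | no x≢0  | yes eq = yes (x≢0 , eq)
  ... | no _    | no neq = no λ (_ , eq) → neq eq

  x^[2Q+1] : ∀ x → x ^ᶠ (2 ℕ.* Q ℕ.+ 1) ≡ x * φ x * φ x
  x^[2Q+1] x = begin
    x ^ᶠ (2 ℕ.* Q ℕ.+ 1)                   ≡⟨ cong (x ^ᶠ_) (ℕ.+-comm (2 ℕ.* Q) 1) ⟩
    x * x ^ᶠ (Q ℕ.+ (Q ℕ.+ 0))             ≡⟨ cong (λ n → x * x ^ᶠ (Q ℕ.+ n)) (ℕ.+-identityʳ Q) ⟩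
    x * x ^ᶠ (Q ℕ.+ Q)                     ≡⟨ cong (x *_) (^-homo-* x Q Q) ⟩
    x * (φ x * φ x)                        ≡⟨ *-assoc x (φ x) (φ x) ⟨
    x * φ x * φ x                          ∎
    where open ≡-Reasoning

  numC≡numerator : ∀ x → numC x ≡ numerator x (φ x)
  numC≡numerator x = cong₂ (λ a c → a - c + 1#) (x^[2Q+1] x) (cong (x ^ᶠ_) (ℕ.+-comm Q 1))

  denC≡denominator : ∀ x → denC x ≡ denominator x (φ x)
  denC≡denominator x = cong (λ a → a - φ x + 1#) (x^[2Q+1] x)

  numC/denC≡ratio : ∀ x → numC x * denC x ⁻¹ ≡ ratio x
  numC/denC≡ratio x = cong₂ (λ n d → n * d ⁻¹) (numC≡numerator x) (denC≡denominator x)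

  partC-permutes : PermutesRat field' μ numC denC
  partC-permutes = (λ x μx d≡0 → denominator≢0 (μ⇒unit μx) (trans (sym (denC≡denominator x)) d≡0)) ,
    injective⇒permutesOn μ μ? _
      (λ x μx → subst μ (sym (numC/denC≡ratio x)) (unit⇒μ (ratio-unit (μ⇒unit μx))))
      (λ x y μx μy eq → ratio-injective (μ⇒unit μx) (μ⇒unit μy)
        (trans (sym (numC/denC≡ratio x)) (trans eq (numC/denC≡ratio y))))

  claim : Claim
  claim = F₆-permutes , (λ ν ν∈FQ2 nonsquare → PartB.permutes ν∈FQ2 nonsquare) , partC-permutes

theorem7p1 : (Q : ℕ) → IsOddPrimePower Q →
    (K : FiniteField (Q ^ 4)) → Thm7p1.Claim Q K
theorem7p1 Q (p , k , p-prime , p≢2 , _ , Q≡p^k) K = Main.claim Q {k = k} p-prime p≢2 Q≡p^k K
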